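{- If $G$ is a connected graph of order $n$ with diameter $d$, then $$m_{D^{L}(G)}[0,dn]\geq d+1.$$
   Context: All graphs are finite, simple and connected. For a connected graph $G$ with vertex set $\{v_1,\dots,v_n\}$, $d_{uv}$ is the length of a shortest path between $u$ and $v$, the diameter is the maximum of the $d_{uv}$, $D(G)=(d_{uv})$ is the distance matrix, $Tr(v)=\sum_{u\in V(G)}d_{uv}$ is the transmission of $v$, and the distance Laplacian matrix is $D^L(G)=\mathrm{diag}(Tr(v_1),\dots,Tr(v_n))-D(G)$. Its eigenvalues (all real) are the distance Laplacian eigenvalues of $G$. For an interval $I\subseteq\mathbb{R}$, $m_{D^L(G)}I$ denotes the number of distance Laplacian eigenvalues of $G$, counted with multiplicity, lying in $I$. -}

module Defs where

open import Algebra.Bundles.Raw using (RawRing)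
import Algebra.Definitions.RawMonoid as RawSum
open import Data.Fin as Fin using (Fin; zero; suc; toℕ; inject₁; fromℕ)
import Data.Fin.Properties as Fin
open import Data.Fin.Subset using (Subset; _∈_; ∣_∣)
open import Data.Integer as ℤ using (ℤ)
open import Data.List using (allFin; cartesianProductWith)
open import Data.List.Extrema.Nat using (max)
open import Data.Nat as ℕ using (ℕ; zero; suc)
import Data.Nat.Properties as ℕ
open import Data.Product using (∃; ∃-syntax; _×_; _,_; proj₁)
open import Data.Rational as ℚ using (ℚ; 0ℚ; 1ℚ; ½)
import Data.Rational.Properties as ℚ
open import Data.Rational.Solver using (module +-*-Solver)
open import Data.Vec as Vec using (Vec; []; _∷_; lookup)
open import Data.Vec.Functional as Vector using (Vector; removeAt)
open import Function using (_∘_; _⇔_)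
open import Level using (0ℓ)
open import Relation.Binary using (Symmetric; Irreflexive; Decidable)
open import Relation.Binary.PropositionalEquality
  using (_≡_; refl; sym; trans; cong; subst)
open import Relation.Nullary using (Dec; yes; no; contradiction)
open import Relation.Nullary.Decidable using (map′; _×-dec_; _→-dec_)
open import Relation.Unary as Unary using (Pred)

-- Real numbers: Cauchy sequences of rationals, considered up to _≈ℝ_.

IsCauchy : (ℕ → ℚ) → Set
IsCauchy x = ∀ {ε} → 0ℚ ℚ.< ε →
  ∃[ N ] (∀ {i j} → N ℕ.≤ i → N ℕ.≤ j → ℚ.∣ x i ℚ.- x j ∣ ℚ.< ε)

record ℝ : Set where
  constructor mkℝ
  field
    seq    : ℕ → ℚ
    cauchy : IsCauchy seq

open ℝ public

infix 4 _≈ℝ_ _≤ℝ_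

_≈ℝ_ : ℝ → ℝ → Set
x ≈ℝ y = ∀ {ε} → 0ℚ ℚ.< ε →
  ∃[ N ] (∀ {i} → N ℕ.≤ i → ℚ.∣ seq x i ℚ.- seq y i ∣ ℚ.< ε)

_≤ℝ_ : ℝ → ℝ → Set
x ≤ℝ y = ∀ {ε} → 0ℚ ℚ.< ε →
  ∃[ N ] (∀ {i} → N ℕ.≤ i → seq x i ℚ.≤ seq y i ℚ.+ ε)

abstract
  half-pos : ∀ {ε} → 0ℚ ℚ.< ε → 0ℚ ℚ.< ½ ℚ.* ε
  half-pos {ε} ε>0 =
    subst (ℚ._< ½ ℚ.* ε) (ℚ.*-zeroʳ ½) (ℚ.*-monoʳ-<-pos ½ ε>0)

  half+half : ∀ ε → ½ ℚ.* ε ℚ.+ ½ ℚ.* ε ≡ ε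
  half+half ε =
    trans (sym (ℚ.*-distribʳ-+ ε ½ ½)) (ℚ.*-identityˡ ε)

  const-cauchy : ∀ q → IsCauchy (λ _ → q)
  const-cauchy q {ε} ε>0 =
    0 , λ _ _ → subst (ℚ._< ε) (cong ℚ.∣_∣ (sym (ℚ.+-inverseʳ q))) ε>0

  +-cauchy : ∀ {x y} → IsCauchy x → IsCauchy y → IsCauchy (λ i → x i ℚ.+ y i)
  +-cauchy {x} {y} cx cy {ε} ε>0
    with cx (half-pos ε>0) | cy (half-pos ε>0)
  ... | M , p | N , q = M ℕ.⊔ N , λ {i} {j} i≥ j≥ →
    let open ℚ.≤-Reasoning in begin-strict
      ℚ.∣ (x i ℚ.+ y i) ℚ.- (x j ℚ.+ y j) ∣
        ≡⟨ cong ℚ.∣_∣ (regroup (x i) (y i) (x j) (y j)) ⟩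
      ℚ.∣ (x i ℚ.- x j) ℚ.+ (y i ℚ.- y j) ∣
        ≤⟨ ℚ.∣p+q∣≤∣p∣+∣q∣ (x i ℚ.- x j) (y i ℚ.- y j) ⟩
      ℚ.∣ x i ℚ.- x j ∣ ℚ.+ ℚ.∣ y i ℚ.- y j ∣
        <⟨ ℚ.+-mono-< (p (ℕ.m⊔n≤o⇒m≤o M N i≥) (ℕ.m⊔n≤o⇒m≤o M N j≥))
                      (q (ℕ.m⊔n≤o⇒n≤o M N i≥) (ℕ.m⊔n≤o⇒n≤o M N j≥)) ⟩
      ½ ℚ.* ε ℚ.+ ½ ℚ.* ε
        ≡⟨ half+half ε ⟩
      ε ∎
    where
    open +-*-Solver
    regroup : ∀ a b c d →
      (a ℚ.+ b) ℚ.- (c ℚ.+ d) ≡ (a ℚ.- c) ℚ.+ (b ℚ.- d)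
    regroup = solve 4 (λ a b c d →
      (a :+ b) :- (c :+ d) := (a :- c) :+ (b :- d)) refl

  neg-cauchy : ∀ {x} → IsCauchy x → IsCauchy (λ i → ℚ.- x i)
  neg-cauchy {x} cx {ε} ε>0 with cx ε>0
  ... | N , p = N , λ {i} {j} i≥ j≥ →
    subst (ℚ._< ε)
      (trans (sym (ℚ.∣-p∣≡∣p∣ (x i ℚ.- x j)))
             (cong ℚ.∣_∣ (ℚ.neg-distrib-+ (x i) (ℚ.- x j))))
      (p i≥ j≥)

  bounded : ∀ {x} → IsCauchy x →
    ∃[ B ] (0ℚ ℚ.< B × ∃[ N ] (∀ {i} → N ℕ.≤ i → ℚ.∣ x i ∣ ℚ.≤ B))
  bounded {x} cx with cx {1ℚ} (ℚ.positive⁻¹ 1ℚ)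
  ... | N , p =
    1ℚ ℚ.+ ℚ.∣ x N ∣ ,
    ℚ.+-mono-<-≤ (ℚ.positive⁻¹ 1ℚ) (ℚ.0≤∣p∣ (x N)) ,
    N , λ {i} i≥ → let open ℚ.≤-Reasoning in begin
      ℚ.∣ x i ∣                        ≡⟨ cong ℚ.∣_∣ (split (x i) (x N)) ⟩
      ℚ.∣ (x i ℚ.- x N) ℚ.+ x N ∣       ≤⟨ ℚ.∣p+q∣≤∣p∣+∣q∣ (x i ℚ.- x N) (x N) ⟩
      ℚ.∣ x i ℚ.- x N ∣ ℚ.+ ℚ.∣ x N ∣
        ≤⟨ ℚ.+-monoˡ-≤ ℚ.∣ x N ∣ (ℚ.<⇒≤ (p i≥ ℕ.≤-refl)) ⟩
      1ℚ ℚ.+ ℚ.∣ x N ∣ ∎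
    where
    open +-*-Solver
    split : ∀ a b → a ≡ (a ℚ.- b) ℚ.+ b
    split = solve 2 (λ a b → a := (a :- b) :+ b) refl

  scale : ∀ {B ε} → 0ℚ ℚ.< B → 0ℚ ℚ.< ε →
    ∃[ δ ] (0ℚ ℚ.< δ ×
            (∀ {a b} → ℚ.∣ a ∣ ℚ.≤ B → ℚ.∣ b ∣ ℚ.< δ → ℚ.∣ a ℚ.* b ∣ ℚ.< ε))
  scale {B} {ε} B>0 ε>0 = δ , δ>0 , λ {a} {b} a≤ b< →
    let open ℚ.≤-Reasoning in begin-strict
      ℚ.∣ a ℚ.* b ∣         ≡⟨ ℚ.∣p*q∣≡∣p∣*∣q∣ a b ⟩
      ℚ.∣ a ∣ ℚ.* ℚ.∣ b ∣
        ≤⟨ ℚ.*-monoʳ-≤-nonNeg ℚ.∣ b ∣ {{ℚ.∣-∣-nonNeg b}} a≤ ⟩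
      B ℚ.* ℚ.∣ b ∣         <⟨ ℚ.*-monoʳ-<-pos B b< ⟩
      B ℚ.* δ               ≡⟨ ℚ.*-assoc B (ℚ.1/ B) ε ⟨
      (B ℚ.* ℚ.1/ B) ℚ.* ε  ≡⟨ cong (ℚ._* ε) (ℚ.*-inverseʳ B) ⟩
      1ℚ ℚ.* ε              ≡⟨ ℚ.*-identityˡ ε ⟩
      ε ∎
    where
    instance
      B-pos : ℚ.Positive B
      B-pos = ℚ.positive B>0
      B-nz : ℚ.NonZero B
      B-nz = ℚ.pos⇒nonZero B
      1/B-pos : ℚ.Positive (ℚ.1/ B)
      1/B-pos = ℚ.1/pos⇒pos B
    δ : ℚ
    δ = ℚ.1/ B ℚ.* ε
    δ>0 : 0ℚ ℚ.< δ
    δ>0 = subst (ℚ._< δ) (ℚ.*-zeroʳ (ℚ.1/ B)) (ℚ.*-monoʳ-<-pos (ℚ.1/ B) ε>0)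

  *-cauchy : ∀ {x y} → IsCauchy x → IsCauchy y → IsCauchy (λ i → x i ℚ.* y i)
  *-cauchy {x} {y} cx cy {ε} ε>0 =
    let (B , B>0 , K , x≤)   = bounded {x} cx
        (C , C>0 , L , y≤)   = bounded {y} cy
        (δ , δ>0 , scaleˣ)   = scale {B} B>0 (half-pos ε>0)
        (η , η>0 , scaleʸ)   = scale {C} C>0 (half-pos ε>0)
        (M , q)              = cy δ>0
        (N , p)              = cx η>0
    in
    (K ℕ.⊔ L) ℕ.⊔ (M ℕ.⊔ N) , λ {i} {j} i≥ j≥ →
      let KL≤i = ℕ.m⊔n≤o⇒m≤o (K ℕ.⊔ L) (M ℕ.⊔ N) i≥
          MN≤i = ℕ.m⊔n≤o⇒n≤o (K ℕ.⊔ L) (M ℕ.⊔ N) i≥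
          KL≤j = ℕ.m⊔n≤o⇒m≤o (K ℕ.⊔ L) (M ℕ.⊔ N) j≥
          MN≤j = ℕ.m⊔n≤o⇒n≤o (K ℕ.⊔ L) (M ℕ.⊔ N) j≥
      in combine (x i) (y i) (x j) (y j)
           (scaleˣ {x i} {y i ℚ.- y j} (x≤ (ℕ.m⊔n≤o⇒m≤o K L KL≤i))
             (q (ℕ.m⊔n≤o⇒m≤o M N MN≤i) (ℕ.m⊔n≤o⇒m≤o M N MN≤j)))
           (scaleʸ {y j} {x i ℚ.- x j} (y≤ (ℕ.m⊔n≤o⇒n≤o K L KL≤j))
             (p (ℕ.m⊔n≤o⇒n≤o M N MN≤i) (ℕ.m⊔n≤o⇒n≤o M N MN≤j)))
    where
    open +-*-Solver
    regroup : ∀ a b c d →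
      a ℚ.* b ℚ.- c ℚ.* d ≡ a ℚ.* (b ℚ.- d) ℚ.+ d ℚ.* (a ℚ.- c)
    regroup = solve 4 (λ a b c d →
      a :* b :- c :* d := a :* (b :- d) :+ d :* (a :- c)) refl

    combine : ∀ a b c d →
      ℚ.∣ a ℚ.* (b ℚ.- d) ∣ ℚ.< ½ ℚ.* ε → ℚ.∣ d ℚ.* (a ℚ.- c) ∣ ℚ.< ½ ℚ.* ε →
      ℚ.∣ a ℚ.* b ℚ.- c ℚ.* d ∣ ℚ.< ε
    combine a b c d h k = let open ℚ.≤-Reasoning in begin-strict
      ℚ.∣ a ℚ.* b ℚ.- c ℚ.* d ∣
        ≡⟨ cong ℚ.∣_∣ (regroup a b c d) ⟩
      ℚ.∣ a ℚ.* (b ℚ.- d) ℚ.+ d ℚ.* (a ℚ.- c) ∣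
        ≤⟨ ℚ.∣p+q∣≤∣p∣+∣q∣ (a ℚ.* (b ℚ.- d)) (d ℚ.* (a ℚ.- c)) ⟩
      ℚ.∣ a ℚ.* (b ℚ.- d) ∣ ℚ.+ ℚ.∣ d ℚ.* (a ℚ.- c) ∣
        <⟨ ℚ.+-mono-< h k ⟩
      ½ ℚ.* ε ℚ.+ ½ ℚ.* ε
        ≡⟨ half+half ε ⟩
      ε ∎

ℚ→ℝ : ℚ → ℝ
ℚ→ℝ q = mkℝ (λ _ → q) (const-cauchy q)

ℤ→ℝ : ℤ → ℝ
ℤ→ℝ z = ℚ→ℝ (z ℚ./ 1)

ℕ→ℝ : ℕ → ℝ
ℕ→ℝ k = ℤ→ℝ (ℤ.+ k)

ℝ-rawRing : RawRing 0ℓ 0ℓ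
ℝ-rawRing = record
  { Carrier = ℝ
  ; _≈_     = _≈ℝ_
  ; _+_     = λ x y → mkℝ (λ i → seq x i ℚ.+ seq y i)
                          (+-cauchy {seq x} {seq y} (cauchy x) (cauchy y))
  ; _*_     = λ x y → mkℝ (λ i → seq x i ℚ.* seq y i)
                          (*-cauchy {seq x} {seq y} (cauchy x) (cauchy y))
  ; -_      = λ x → mkℝ (λ i → ℚ.- seq x i) (neg-cauchy {seq x} (cauchy x))
  ; 0#      = ℚ→ℝ 0ℚ
  ; 1#      = ℚ→ℝ 1ℚ
  }

[_,_] : ℝ → ℝ → Pred ℝ 0ℓ
[ a , b ] x = a ≤ℝ x × x ≤ℝ b

Matrix : Set → ℕ → Set
Matrix A n = Fin n → Fin n → A

diag : ∀ {A : Set} {n} → A → Vector A n → Matrix A n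
diag 0# v i j with i Fin.≟ j
... | yes _ = v i
... | no  _ = 0#

module Det (R : RawRing 0ℓ 0ℓ) where
  open RawRing R

  private
    Σ[_] : ∀ {n} → Vector Carrier n → Carrier
    Σ[_] = RawSum.sum +-rawMonoid

  infixr 8 -1^_·_
  -1^_·_ : ℕ → Carrier → Carrier
  -1^ zero  · x = x
  -1^ suc k · x = - (-1^ k · x)

  det : ∀ {n} → Matrix Carrier n → Carrier
  det {zero}  A = 1#
  det {suc n} A =
    Σ[ (λ j → -1^ toℕ j · (A zero j * det (λ i → removeAt (A (suc i)) j))) ]

  charPoly : ∀ {n} → Matrix Carrier n → Carrier → Carrier
  charPoly A x = det (λ i j → diag 0# (λ _ → x) i j + - A i j)

  -- λs lists the eigenvalues of A, repeated according to multiplicity: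
  -- det (x I - A) = ∏ᵢ (x - λᵢ).  The identity of polynomials in x is stated as
  -- agreement at every x; for real numbers, an infinite field, this is the same.
  -- A real symmetric matrix has such a list, unique up to order.
  Eigenvalues : ∀ {n} → Matrix Carrier n → Vector Carrier n → Set
  Eigenvalues A λs =
    ∀ x → charPoly A x ≈ RawSum.sum *-rawMonoid (λ i → x + - λs i)

open Det ℝ-rawRing public using (det; charPoly; Eigenvalues)

-- Exactly m of the entries of xs, counted with repetition, satisfy P.
Count : ∀ {n} → Pred ℝ 0ℓ → Vector ℝ n → ℕ → Set
Count {n} P xs m =
  ∃[ S ] (∣ S ∣ ≡ m × (∀ (i : Fin n) → i ∈ S ⇔ P (xs i)))

record Graph (n : ℕ) : Set₁ where
  field
    Adj    : Fin n → Fin n → Set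
    adj?   : Decidable Adj
    symm   : Symmetric Adj
    irrefl : Irreflexive _≡_ Adj

module _ {n : ℕ} (G : Graph n) where
  open Graph G

  record IsPath (u v : Fin n) {k : ℕ} (p : Vec (Fin n) (suc k)) : Set where
    constructor mkPath
    field
      start    : lookup p zero ≡ u
      end      : lookup p (fromℕ k) ≡ v
      step     : ∀ i → Adj (lookup p (inject₁ i)) (lookup p (suc i))
      distinct : ∀ i j → lookup p i ≡ lookup p j → i ≡ j

  HasPath : Fin n → Fin n → ℕ → Set
  HasPath u v k = ∃[ p ] IsPath u v {k} p

  Connected : Set
  Connected = ∀ u v → ∃[ k ] HasPath u v k

  isPath? : ∀ u v {k} → Unary.Decidable (IsPath u v {k})
  isPath? u v {k} p =
    map′ (λ (a , b , c , d) → mkPath a b c d)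
         (λ (mkPath a b c d) → a , b , c , d)
         (lookup p zero Fin.≟ u
           ×-dec lookup p (fromℕ k) Fin.≟ v
           ×-dec Fin.all? (λ i → adj? (lookup p (inject₁ i)) (lookup p (suc i)))
           ×-dec Fin.all? (λ i → Fin.all? (λ j →
                   lookup p i Fin.≟ lookup p j →-dec i Fin.≟ j)))

anyVec? : ∀ {n k} {P : Pred (Vec (Fin n) k) 0ℓ} →
  Unary.Decidable P → Dec (∃ P)
anyVec? {k = zero} P? =
  map′ (λ p → [] , p) (λ where ([] , p) → p) (P? [])
anyVec? {k = suc k} P? =
  map′ (λ (x , xs , p) → x ∷ xs , p) (λ where (x ∷ xs , p) → x , xs , p)
       (Fin.any? (λ x → anyVec? (λ xs → P? (x ∷ xs))))

least : ∀ {P : Pred ℕ 0ℓ} → Unary.Decidable P → ∀ k → P k →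
  ∃[ m ] (P m × (∀ j → P j → m ℕ.≤ j))
least P? k pk with P? 0
least P? k       pk | yes p0 = 0 , p0 , λ _ _ → ℕ.z≤n
least P? zero    pk | no ¬p0 = contradiction pk ¬p0
least P? (suc k) pk | no ¬p0 with least (P? ∘ suc) k pk
... | m , pm , minimal = suc m , pm , λ where
  zero    p0 → contradiction p0 ¬p0
  (suc j) pj → ℕ.s≤s (minimal j pj)

module _ {n : ℕ} (G : Graph n) (conn : Connected G) where

  shortestPath : ∀ u v →
    ∃[ k ] (HasPath G u v k × (∀ j → HasPath G u v j → k ℕ.≤ j))
  shortestPath u v =
    let (k , p) = conn u v in
    least {HasPath G u v} (λ _ → anyVec? (isPath? G u v)) k p

  dist : Fin n → Fin n → ℕ
  dist u v = proj₁ (shortestPath u v)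

  -- The 0 only matters when there are no vertices.
  diameter : ℕ
  diameter = max 0 (cartesianProductWith dist (allFin n) (allFin n))

  transmission : Fin n → ℕ
  transmission v = RawSum.sum ℕ.+-0-rawMonoid (λ u → dist u v)

  distanceLaplacian : Matrix ℤ n
  distanceLaplacian i j =
    diag (ℤ.+ 0) (λ v → ℤ.+ transmission v) i j ℤ.- ℤ.+ dist i j

  distanceLaplacianℝ : Matrix ℝ n
  distanceLaplacianℝ i j = ℤ→ℝ (distanceLaplacian i j)

{-# OPTIONS --safe #-}

-- All n eigenvalues lie in [0, dn].  The quadratic form of D^L is the sum of d(u,v) (y_u - y_v)²
-- over pairs, hence between 0 and the form of d (n I - J), which is at most dn |y|².
-- Over ℚ, if the quadratic form of a matrix is at least ε |y|² in absolute value, pivoting on the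
-- corner (Schur complement) preserves this, so the determinant is at least ε^n in absolute value.
-- Applied to x I - D^L for the rational approximations x of an eigenvalue, whose characteristic
-- polynomial values tend to 0, this prevents x from staying ε outside [0, dn].
-- Finally n ≥ d + 1, since the vertices of a shortest path are distinct.

module Submission where

open import Defs
open import Data.Nat using (ℕ; NonZero; _+_; _*_; _≥_)
open import Data.Product using (∃-syntax; _×_)
open import Data.Vec.Functional using (Vector)

open import Algebra.Bundles using (CommutativeRing)
open import Algebra.Bundles.Raw using (RawRing)
import Algebra.Definitions.RawMonoid as RawSum
import Algebra.Definitions.RawSemiring
import Algebra.Properties.Ring
import Algebra.Properties.Semiring.Sum
open import Data.Fin as Fin
  using (Fin; zero; suc; toℕ; inject₁; punchIn; punchOut; fromℕ; opposite)
open import Data.Fin.Induction using (<-weakInduction)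
import Data.Fin.Properties as Fin
open import Data.Fin.Subset using (⊤)
open import Data.Fin.Subset.Properties using (∈⊤; ∣⊤∣≡n)
import Data.Integer as ℤ
import Data.Integer.Properties as ℤ
open import Data.List using (allFin; cartesianProductWith)
open import Data.List.Extrema.Nat using (xs≤max; max<v⁺)
import Data.List.Membership.Propositional.Properties as List
import Data.List.Relation.Unary.All as All
import Data.List.Relation.Unary.All.Properties as All
open import Data.Nat as ℕ using (zero; suc)
import Data.Nat.Properties as ℕ
open import Data.Product using (_,_; proj₁; proj₂)
open import Data.Rational as ℚ using (ℚ; 0ℚ; 1ℚ)
import Data.Rational.Properties as ℚ
open import Data.Rational.Solver using (module +-*-Solver)
import Data.Rational.Unnormalised as ℚᵘ
import Data.Rational.Unnormalised.Properties as ℚᵘ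
open import Data.Sum using (_⊎_; inj₁; inj₂)
open import Data.Vec using (lookup; tabulate)
open import Data.Vec.Functional using (_∷_; removeAt; updateAt)
open import Data.Vec.Functional.Properties using (updateAt-updates; updateAt-minimal)
open import Data.Vec.Properties using (lookup∘tabulate)
open import Function using (_∘_; const; mk⇔)
open import Level using (0ℓ)
open import Relation.Binary.PropositionalEquality as ≡ using (_≡_; _≢_)
open import Relation.Nullary using (¬_; yes; no; contradiction)

-- Determinants

-- Deleting a column outside an adjacent pair leaves the pair adjacent, which lets the induction in
-- `det-adjacent` pass to minors.
punchIn-adjacent : ∀ {n} (j : Fin (suc (suc n))) (k : Fin (suc n)) →
  j ≢ inject₁ k → j ≢ suc k →
  ∃[ l ] punchIn j (inject₁ l) ≡ inject₁ k × punchIn j (suc l) ≡ suc k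
punchIn-adjacent zero zero 0≢0 _ = contradiction ≡.refl 0≢0
punchIn-adjacent {suc n} zero (suc k) _ _ = k , ≡.refl , ≡.refl
punchIn-adjacent (suc zero) zero _ 1≢1 = contradiction ≡.refl 1≢1
punchIn-adjacent {suc n} (suc (suc j)) zero _ _ = zero , ≡.refl , ≡.refl
punchIn-adjacent {suc n} (suc j) (suc k) j≢ j≢′
  with punchIn-adjacent j k (j≢ ∘ ≡.cong suc) (j≢′ ∘ ≡.cong suc)
... | l , eq , eq′ = suc l , ≡.cong suc eq , ≡.cong suc eq′

-- Deleting one of two adjacent columns or the other leaves the same list except in one place, where
-- the survivor of the pair stands. If the two columns agree, so do the two minors.
punchIn-inject₁-suc : ∀ {n} (k l : Fin n) →
  punchIn (inject₁ k) l ≡ punchIn (suc k) l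
  ⊎ punchIn (inject₁ k) l ≡ suc k × punchIn (suc k) l ≡ inject₁ k
punchIn-inject₁-suc zero zero = inj₂ (≡.refl , ≡.refl)
punchIn-inject₁-suc zero (suc l) = inj₁ ≡.refl
punchIn-inject₁-suc (suc k) zero = inj₁ ≡.refl
punchIn-inject₁-suc (suc k) (suc l) with punchIn-inject₁-suc k l
... | inj₁ eq = inj₁ (≡.cong suc eq)
... | inj₂ (eq , eq′) = inj₂ (≡.cong suc eq , ≡.cong suc eq′)

module Determinant (R : CommutativeRing 0ℓ 0ℓ) where
  open CommutativeRing R hiding (zero) renaming (_+_ to _⊕_; _*_ to _⊗_)
  open Det rawRing using (-1^_·_) renaming (det to ∣_∣)
  open Algebra.Properties.Ring ring
    using (-‿+-comm; -‿distribʳ-*; -0#≈0#)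
  open Algebra.Properties.Semiring.Sum semiring
    using (sum; sum-cong-≋; sum-replicate-zero; ∑-distrib-+; *-distribˡ-sum)
  open import Relation.Binary.Reasoning.Setoid setoid

  -1^-cong : ∀ k {x y} → x ≈ y → -1^ k · x ≈ -1^ k · y
  -1^-cong zero    x≈y = x≈y
  -1^-cong (suc k) x≈y = -‿cong (-1^-cong k x≈y)

  -1^-zero : ∀ k {x} → x ≈ 0# → -1^ k · x ≈ 0#
  -1^-zero zero    x≈0 = x≈0
  -1^-zero (suc k) x≈0 = trans (-‿cong (-1^-zero k x≈0)) -0#≈0#

  -1^-linear : ∀ k x t y → -1^ k · (x ⊕ t ⊗ y) ≈ -1^ k · x ⊕ t ⊗ -1^ k · y
  -1^-linear zero    x t y = refl
  -1^-linear (suc k) x t y = begin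
    - (-1^ k · (x ⊕ t ⊗ y))              ≈⟨ -‿cong (-1^-linear k x t y) ⟩
    - (-1^ k · x ⊕ t ⊗ -1^ k · y)        ≈⟨ -‿+-comm _ _ ⟨
    - (-1^ k · x) ⊕ - (t ⊗ -1^ k · y)    ≈⟨ +-congˡ (-‿distribʳ-* _ _) ⟩
    - (-1^ k · x) ⊕ t ⊗ - (-1^ k · y)    ∎

  sum-zero : ∀ {n} {f : Vector Carrier n} → (∀ i → f i ≈ 0#) → sum f ≈ 0#
  sum-zero {n} f≈0 = trans (sum-cong-≋ f≈0) (sum-replicate-zero n)

  sum-linear : ∀ {n} (f : Vector Carrier n) t g →
    sum (λ i → f i ⊕ t ⊗ g i) ≈ sum f ⊕ t ⊗ sum g
  sum-linear f t g =
    trans (∑-distrib-+ f (λ i → t ⊗ g i)) (+-congˡ (sym (*-distribˡ-sum t g)))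

  sum-adjacent-zero : ∀ {n} (f : Vector Carrier (suc n)) k →
    f (inject₁ k) ⊕ f (suc k) ≈ 0# →
    (∀ j → j ≢ inject₁ k → j ≢ suc k → f j ≈ 0#) → sum f ≈ 0#
  sum-adjacent-zero f zero eq eq₀ = begin
    f zero ⊕ (f (suc zero) ⊕ sum (λ i → f (suc (suc i))))  ≈⟨ +-assoc _ _ _ ⟨
    (f zero ⊕ f (suc zero)) ⊕ sum (λ i → f (suc (suc i)))
      ≈⟨ +-cong eq (sum-zero (λ i → eq₀ (suc (suc i)) (λ ()) (λ ()))) ⟩
    0# ⊕ 0#                                                ≈⟨ +-identityˡ 0# ⟩
    0#                                                     ∎
  sum-adjacent-zero f (suc k) eq eq₀ = begin
    f zero ⊕ sum (f ∘ suc)  ≈⟨ +-cong (eq₀ zero (λ ()) (λ ())) (sum-adjacent-zero (f ∘ suc) k eq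
                               (λ j j≢ j≢′ → eq₀ (suc j) (j≢ ∘ Fin.suc-injective)
                                                         (j≢′ ∘ Fin.suc-injective))) ⟩
    0# ⊕ 0#                 ≈⟨ +-identityˡ 0# ⟩
    0#                      ∎

  minor : ∀ {n} → Matrix Carrier (suc n) → Fin (suc n) → Matrix Carrier n
  minor A j i = removeAt (A (suc i)) j

  term : ∀ {n} → Matrix Carrier (suc n) → Fin (suc n) → Carrier
  term A j = -1^ toℕ j · (A zero j ⊗ ∣ minor A j ∣)

  -- Linearity and alternation in the columns

  det-cong : ∀ {n} {A B : Matrix Carrier n} → (∀ i j → A i j ≈ B i j) → ∣ A ∣ ≈ ∣ B ∣
  det-cong {zero}  A≈B = refl
  det-cong {suc n} {A} {B} A≈B = sum-cong-≋ {x = term A} {y = term B} λ j →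
    -1^-cong (toℕ j) (*-cong (A≈B zero j) (det-cong (λ i l → A≈B (suc i) (punchIn j l))))

  -- Induction along the first-row expansion. The term at `k` is linear through its entry, its minor
  -- having lost column `k`; every other term is linear through its minor, by induction.
  det-column-linear : ∀ {n} (A B C : Matrix Carrier n) k t →
    (∀ i → A i k ≈ B i k ⊕ t ⊗ C i k) →
    (∀ i j → j ≢ k → A i j ≈ B i j) → (∀ i j → j ≢ k → A i j ≈ C i j) →
    ∣ A ∣ ≈ ∣ B ∣ ⊕ t ⊗ ∣ C ∣
  det-column-linear {suc n} A B C k t A≈B+tC A≈B A≈C = begin
    sum (term A)                           ≈⟨ sum-cong-≋ terms ⟩
    sum (λ j → term B j ⊕ t ⊗ term C j)    ≈⟨ sum-linear (term B) t (term C) ⟩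
    ∣ B ∣ ⊕ t ⊗ ∣ C ∣                      ∎
    where
    products : ∀ j → A zero j ⊗ ∣ minor A j ∣ ≈
      B zero j ⊗ ∣ minor B j ∣ ⊕ t ⊗ (C zero j ⊗ ∣ minor C j ∣)
    products j with j Fin.≟ k
    ... | yes ≡.refl = begin
      A zero j ⊗ ∣ minor A j ∣                              ≈⟨ *-congʳ (A≈B+tC zero) ⟩
      (B zero j ⊕ t ⊗ C zero j) ⊗ ∣ minor A j ∣             ≈⟨ distribʳ _ _ _ ⟩
      B zero j ⊗ ∣ minor A j ∣ ⊕ t ⊗ C zero j ⊗ ∣ minor A j ∣
        ≈⟨ +-cong (*-congˡ (det-cong λ i l → A≈B (suc i) _ (Fin.punchInᵢ≢i j l)))
                  (trans (*-assoc _ _ _) (*-congˡ (*-congˡ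
                    (det-cong λ i l → A≈C (suc i) _ (Fin.punchInᵢ≢i j l))))) ⟩
      B zero j ⊗ ∣ minor B j ∣ ⊕ t ⊗ (C zero j ⊗ ∣ minor C j ∣)  ∎
    ... | no j≢k = begin
      A zero j ⊗ ∣ minor A j ∣
        ≈⟨ *-congˡ (det-column-linear (minor A j) (minor B j) (minor C j) (punchOut j≢k) t
             (λ i → at (λ l → A (suc i) l ≈ B (suc i) l ⊕ t ⊗ C (suc i) l) (A≈B+tC (suc i)))
             (λ i l l≢ → A≈B (suc i) _ (off l≢)) (λ i l l≢ → A≈C (suc i) _ (off l≢))) ⟩
      A zero j ⊗ (∣ minor B j ∣ ⊕ t ⊗ ∣ minor C j ∣)          ≈⟨ distribˡ _ _ _ ⟩
      A zero j ⊗ ∣ minor B j ∣ ⊕ A zero j ⊗ (t ⊗ ∣ minor C j ∣)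
        ≈⟨ +-cong (*-congʳ (A≈B zero j j≢k))
             (trans (sym (*-assoc _ _ _)) (trans (*-congʳ (*-comm _ _))
               (trans (*-assoc _ _ _) (*-congˡ (*-congʳ (A≈C zero j j≢k)))))) ⟩
      B zero j ⊗ ∣ minor B j ∣ ⊕ t ⊗ (C zero j ⊗ ∣ minor C j ∣)  ∎
      where
      at : (P : Fin (suc _) → Set) → P k → P (punchIn j (punchOut j≢k))
      at P = ≡.subst P (≡.sym (Fin.punchIn-punchOut j≢k))
      off : ∀ {l} → l ≢ punchOut j≢k → punchIn j l ≢ k
      off {l} l≢ eq = l≢ (Fin.punchIn-injective j l _
        (≡.trans eq (≡.sym (Fin.punchIn-punchOut j≢k))))

    terms : ∀ j → term A j ≈ term B j ⊕ t ⊗ term C j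
    terms j = trans (-1^-cong (toℕ j) (products j)) (-1^-linear (toℕ j) _ t _)

  -- The terms at the two equal columns have equal minors and opposite signs. Every other minor
  -- still contains the equal pair, so it vanishes by induction.
  det-adjacent : ∀ {n} (A : Matrix Carrier (suc n)) k →
    (∀ i → A i (inject₁ k) ≈ A i (suc k)) → ∣ A ∣ ≈ 0#
  det-adjacent {suc n} A k A₁≈A₂ = sum-adjacent-zero (term A) k cancel others
    where
    minors : ∀ i l → minor A (inject₁ k) i l ≈ minor A (suc k) i l
    minors i l with punchIn-inject₁-suc k l
    ... | inj₁ eq = reflexive (≡.cong (A (suc i)) eq)
    ... | inj₂ (eq , eq′) = begin
      A (suc i) (punchIn (inject₁ k) l)  ≡⟨ ≡.cong (A (suc i)) eq ⟩
      A (suc i) (suc k)                  ≈⟨ A₁≈A₂ (suc i) ⟨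
      A (suc i) (inject₁ k)              ≡⟨ ≡.cong (A (suc i)) eq′ ⟨
      A (suc i) (punchIn (suc k) l)      ∎

    cancel : term A (inject₁ k) ⊕ term A (suc k) ≈ 0#
    cancel = begin
      term A (inject₁ k) ⊕ term A (suc k)
        -- Expresses both signs through `toℕ k`, so that the second is visibly the negative of the
        -- first.
        ≡⟨ ≡.cong (λ s → -1^ s · x ⊕ term A (suc k)) (Fin.toℕ-inject₁ k) ⟩
      -1^ toℕ k · x ⊕ - (-1^ toℕ k · y)
        ≈⟨ +-congʳ (-1^-cong (toℕ k) (*-cong (A₁≈A₂ zero) (det-cong minors))) ⟩
      -1^ toℕ k · y ⊕ - (-1^ toℕ k · y)
        ≈⟨ -‿inverseʳ _ ⟩
      0# ∎
      where
      x = A zero (inject₁ k) ⊗ ∣ minor A (inject₁ k) ∣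
      y = A zero (suc k) ⊗ ∣ minor A (suc k) ∣

    others : ∀ j → j ≢ inject₁ k → j ≢ suc k → term A j ≈ 0#
    others j j≢ j≢′ with punchIn-adjacent j k j≢ j≢′
    ... | l , eq , eq′ = -1^-zero (toℕ j) (trans (*-congˡ (det-adjacent (minor A j) l λ i →
      begin
        A (suc i) (punchIn j (inject₁ l))  ≡⟨ ≡.cong (A (suc i)) eq ⟩
        A (suc i) (inject₁ k)              ≈⟨ A₁≈A₂ (suc i) ⟩
        A (suc i) (suc k)                  ≡⟨ ≡.cong (A (suc i)) eq′ ⟨
        A (suc i) (punchIn j (suc l))      ∎)) (zeroʳ _))

  -- Column operations

  infixl 7 _[_]≔_
  _[_]≔_ : ∀ {n} → Matrix Carrier n → Fin n → Vector Carrier n → Matrix Carrier n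
  (A [ k ]≔ v) i = updateAt (A i) k (const (v i))

  column-updated : ∀ {n} (A : Matrix Carrier n) k v i → (A [ k ]≔ v) i k ≈ v i
  column-updated A k v i = reflexive (updateAt-updates k (A i))

  column-minimal : ∀ {n} (A : Matrix Carrier n) k v i j → j ≢ k → (A [ k ]≔ v) i j ≈ A i j
  column-minimal A k v i j j≢k = reflexive (updateAt-minimal j k (A i) j≢k)

  -- Linearity in column `k`. Asking only that the determinant with `v` in column `k` vanish, rather
  -- than that `v` be a particular column, lets this serve both before and after the repeated-column
  -- case is known.
  det-addColumn : ∀ {n} (A : Matrix Carrier n) k t v → ∣ A [ k ]≔ v ∣ ≈ 0# →
    ∣ A [ k ]≔ (λ i → A i k ⊕ t ⊗ v i) ∣ ≈ ∣ A ∣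
  det-addColumn A k t v Aᵥ≈0 = begin
    ∣ A [ k ]≔ w ∣              ≈⟨ det-column-linear _ A (A [ k ]≔ v) k t
                                    (λ i → trans (column-updated A k w i)
                                      (+-congˡ (*-congˡ (sym (column-updated A k v i)))))
                                    (λ i j → column-minimal A k w i j)
                                    (λ i j j≢k → trans (column-minimal A k w i j j≢k)
                                      (sym (column-minimal A k v i j j≢k))) ⟩
    ∣ A ∣ ⊕ t ⊗ ∣ A [ k ]≔ v ∣  ≈⟨ +-congˡ (trans (*-congˡ Aᵥ≈0) (zeroʳ t)) ⟩
    ∣ A ∣ ⊕ 0#                  ≈⟨ +-identityʳ _ ⟩
    ∣ A ∣                       ∎
    where
    w : Vector Carrier _
    w i = A i k ⊕ t ⊗ v i

  -- If columns p and p + 1 are v and w, with w also in column zero, then adding v to column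
  -- p + 1 and then w to column p makes both v + w.  The determinant is unchanged, by the adjacent
  -- case for the first addition and by induction for the second.
  det-repeatedColumn : ∀ {n} (k : Fin (suc n)) (A : Matrix Carrier (suc (suc n))) →
    (∀ i → A i zero ≈ A i (suc k)) → ∣ A ∣ ≈ 0#
  det-repeatedColumn {n} = <-weakInduction
    (λ k → ∀ A → (∀ i → A i zero ≈ A i (suc k)) → ∣ A ∣ ≈ 0#)
    (λ A → det-adjacent A zero) step
    where
    step : ∀ (k : Fin n) →
      (∀ A → (∀ i → A i zero ≈ A i (suc (inject₁ k))) → ∣ A ∣ ≈ 0#) →
      ∀ A → (∀ i → A i zero ≈ A i (suc (suc k))) → ∣ A ∣ ≈ 0#
    step k hyp A A₀≈A₂ = begin
      ∣ A ∣   ≈⟨ det-addColumn A q 1# v (det-adjacent (A [ q ]≔ v) (suc k) λ i →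
                   trans (column-minimal A q v i p p≢q) (sym (column-updated A q v i))) ⟨
      ∣ A′ ∣  ≈⟨ det-addColumn A′ p 1# w (hyp (A′ [ p ]≔ w) λ i → sym (column-updated A′ p w i)) ⟨
      ∣ A″ ∣  ≈⟨ det-adjacent A″ (suc k) equal ⟩
      0#      ∎
      where
      p = suc (inject₁ k)
      q = suc (suc k)
      p≢q : p ≢ q
      p≢q eq = ℕ.1+n≢n (≡.sym (≡.trans (≡.sym (Fin.toℕ-inject₁ k))
        (≡.cong toℕ (Fin.suc-injective eq))))
      v w v+w : Vector Carrier (suc (suc n))
      v i = A i p
      w i = A i zero
      v+w i = A i q ⊕ 1# ⊗ v i
      A′ A″ : Matrix Carrier (suc (suc n))
      A′ = A [ q ]≔ v+w
      A″ = A′ [ p ]≔ (λ i → A′ i p ⊕ 1# ⊗ w i)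
      equal : ∀ i → A″ i p ≈ A″ i q
      equal i = begin
        A″ i p              ≈⟨ column-updated A′ p (λ i → A′ i p ⊕ 1# ⊗ w i) i ⟩
        A′ i p ⊕ 1# ⊗ w i   ≈⟨ +-cong (column-minimal A q v+w i p p≢q) (*-identityˡ _) ⟩
        v i ⊕ w i           ≈⟨ +-comm _ _ ⟩
        w i ⊕ v i           ≈⟨ +-cong (A₀≈A₂ i) (sym (*-identityˡ _)) ⟩
        A i q ⊕ 1# ⊗ v i    ≈⟨ column-updated A q v+w i ⟨
        A′ i q              ≈⟨ column-minimal A′ p (λ i → A′ i p ⊕ 1# ⊗ w i) i q (p≢q ∘ ≡.sym) ⟨
        A″ i q              ∎

  -- Elimination in the first row

  det-addFirstColumn : ∀ {n} (A : Matrix Carrier (suc n)) k t →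
    ∣ A [ suc k ]≔ (λ i → A i (suc k) ⊕ t ⊗ A i zero) ∣ ≈ ∣ A ∣
  det-addFirstColumn {suc n} A k t = det-addColumn A (suc k) t w
    (det-repeatedColumn k (A [ suc k ]≔ w) λ i → sym (column-updated A (suc k) w i))
    where
    w : Vector Carrier _
    w i = A i zero

  -- Moves from `t` to `u` one coordinate at a time, the tail by induction and then the head. The
  -- congruence hypothesis stands in for function extensionality, as these vectors are functions.
  coordinatewise-constant : ∀ {n} (f : Vector Carrier n → Carrier) →
    (∀ {t u} → (∀ i → t i ≡ u i) → f t ≈ f u) →
    (∀ t k s → f (updateAt t k (const s)) ≈ f t) → ∀ t u → f t ≈ f u
  coordinatewise-constant {zero} f f-cong f-update t u = f-cong (λ ())
  coordinatewise-constant {suc n} f f-cong f-update t u = begin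
    f t                          ≈⟨ f-cong (λ { zero → ≡.refl ; (suc i) → ≡.refl }) ⟩
    f (t zero ∷ (t ∘ suc))
      ≈⟨ coordinatewise-constant (λ r → f (t zero ∷ r))
           (λ r≡ → f-cong (λ { zero → ≡.refl ; (suc i) → r≡ i }))
           (λ r k s → trans (f-cong (λ { zero → ≡.refl ; (suc i) → ≡.refl }))
                            (f-update (t zero ∷ r) (suc k) s))
           (t ∘ suc) (u ∘ suc) ⟩
    f (t zero ∷ (u ∘ suc))       ≈⟨ f-update _ zero (u zero) ⟨
    f (updateAt (t zero ∷ (u ∘ suc)) zero (const (u zero)))
                                 ≈⟨ f-cong (λ { zero → ≡.refl ; (suc i) → ≡.refl }) ⟩
    f u                          ∎

  shear : ∀ {n} → Matrix Carrier (suc n) → Vector Carrier n → Matrix Carrier (suc n)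
  shear A t i = A i zero ∷ (λ j → A i (suc j) ⊕ t j ⊗ A i zero)

  -- Changing a single multiplier adds a multiple of the first column, which the shear leaves fixed.
  -- So all multipliers can be brought to zero, where the shear is `A` itself.
  det-shear : ∀ {n} (A : Matrix Carrier (suc n)) t → ∣ shear A t ∣ ≈ ∣ A ∣
  det-shear A t = trans
    (coordinatewise-constant (λ t → ∣ shear A t ∣) shear-cong shear-update t (const 0#))
    (det-cong {A = shear A (const 0#)} {B = A} λ where
      i zero    → refl
      i (suc j) → trans (+-congˡ (zeroˡ _)) (+-identityʳ _))
    where
    shear-cong : ∀ {t u} → (∀ i → t i ≡ u i) → ∣ shear A t ∣ ≈ ∣ shear A u ∣
    shear-cong {t} {u} t≡u = det-cong {A = shear A t} {B = shear A u} λ where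
      i zero    → refl
      i (suc j) → +-congˡ (*-congʳ (reflexive (t≡u j)))

    shear-update : ∀ t k s → ∣ shear A (updateAt t k (const s)) ∣ ≈ ∣ shear A t ∣
    shear-update t k s = trans
      (det-cong {A = shear A (updateAt t k (const s))} pointwise)
      -- The column already contains `t k` times the first one, so only the difference is to be
      -- added.
      (det-addFirstColumn (shear A t) k (s - t k))
      where
      column : ∀ i → A i (suc k) ⊕ s ⊗ A i zero ≈
        (A i (suc k) ⊕ t k ⊗ A i zero) ⊕ (s - t k) ⊗ A i zero
      column i = begin
        A i (suc k) ⊕ s ⊗ A i zero                   ≈⟨ +-congˡ (*-congʳ difference) ⟨
        A i (suc k) ⊕ (t k ⊕ (s - t k)) ⊗ A i zero   ≈⟨ +-congˡ (distribʳ _ _ _) ⟩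
        A i (suc k) ⊕ (t k ⊗ A i zero ⊕ (s - t k) ⊗ A i zero)  ≈⟨ +-assoc _ _ _ ⟨
        (A i (suc k) ⊕ t k ⊗ A i zero) ⊕ (s - t k) ⊗ A i zero  ∎
        where
        difference : t k ⊕ (s - t k) ≈ s
        difference = begin
          t k ⊕ (s - t k)    ≈⟨ +-comm _ _ ⟩
          (s - t k) ⊕ t k    ≈⟨ +-assoc _ _ _ ⟩
          s ⊕ (- t k ⊕ t k)  ≈⟨ +-congˡ (-‿inverseˡ _) ⟩
          s ⊕ 0#             ≈⟨ +-identityʳ s ⟩
          s                  ∎

      w : Vector Carrier _
      w i = shear A t i (suc k) ⊕ (s - t k) ⊗ shear A t i zero

      pointwise : ∀ i j → shear A (updateAt t k (const s)) i j ≈ (shear A t [ suc k ]≔ w) i j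
      pointwise i zero = refl
      pointwise i (suc j) with j Fin.≟ k
      ... | yes ≡.refl = begin
        A i (suc j) ⊕ updateAt t j (const s) j ⊗ A i zero
          ≡⟨ ≡.cong (λ r → A i (suc j) ⊕ r ⊗ A i zero) (updateAt-updates j t) ⟩
        A i (suc j) ⊕ s ⊗ A i zero            ≈⟨ column i ⟩
        w i                                   ≈⟨ column-updated (shear A t) (suc j) w i ⟨
        (shear A t [ suc j ]≔ w) i (suc j)    ∎
      ... | no j≢k = begin
        A i (suc j) ⊕ updateAt t k (const s) j ⊗ A i zero
          ≡⟨ ≡.cong (λ r → A i (suc j) ⊕ r ⊗ A i zero) (updateAt-minimal j k t j≢k) ⟩
        shear A t i (suc j)
          ≈⟨ column-minimal (shear A t) (suc k) w i (suc j) (j≢k ∘ Fin.suc-injective) ⟨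
        (shear A t [ suc k ]≔ w) i (suc j)    ∎

  -- The sheared matrix has first row zero beyond the corner, so its expansion has a single term.
  det-pivot : ∀ {n} (A : Matrix Carrier (suc n)) t →
    (∀ j → A zero (suc j) ⊕ t j ⊗ A zero zero ≈ 0#) →
    ∣ A ∣ ≈ A zero zero ⊗ ∣ (λ i j → A (suc i) (suc j) ⊕ t j ⊗ A (suc i) zero) ∣
  det-pivot A t cleared = begin
    ∣ A ∣                                           ≈⟨ det-shear A t ⟨
    term (shear A t) zero ⊕ sum (term (shear A t) ∘ suc)
      ≈⟨ +-congˡ (sum-zero λ j → -1^-zero (suc (toℕ j))
           (trans (*-congʳ (cleared j)) (zeroˡ _))) ⟩
    term (shear A t) zero ⊕ 0#                      ≈⟨ +-identityʳ _ ⟩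
    term (shear A t) zero                           ∎

-- Quadratic forms over ℚ

open ≡ using (refl; sym; trans; cong; cong₂; subst; subst₂; module ≡-Reasoning)
module Detℚ = Det ℚ.+-*-rawRing
open Algebra.Definitions.RawSemiring ℚ.+-*-rawSemiring using (_^_)
open Algebra.Properties.Semiring.Sum (CommutativeRing.semiring ℚ.+-*-commutativeRing)
  using (sum; sum-cong-≋; sum-remove; ∑-comm; *-distribˡ-sum; *-distribʳ-sum)
open Determinant ℚ.+-*-commutativeRing using (det-pivot; det-cong; sum-zero; sum-linear)

0≤p*p : ∀ p → 0ℚ ℚ.≤ p ℚ.* p
0≤p*p p with ℚ.≤-total 0ℚ p
... | inj₁ 0≤p = ℚ.nonNegative⁻¹ _
  {{ℚ.nonNeg*nonNeg⇒nonNeg p {{ℚ.nonNegative 0≤p}} p {{ℚ.nonNegative 0≤p}}}}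
... | inj₂ p≤0 = ℚ.nonNegative⁻¹ _
  {{ℚ.nonPos*nonPos⇒nonPos p {{ℚ.nonPositive p≤0}} p {{ℚ.nonPositive p≤0}}}}

^-positive : ∀ {ε} n → 0ℚ ℚ.< ε → 0ℚ ℚ.< ε ^ n
^-positive zero    ε>0 = ℚ.positive⁻¹ 1ℚ
^-positive {ε} (suc n) ε>0 = ℚ.positive⁻¹ _
  {{ℚ.pos*pos⇒pos ε {{ℚ.positive ε>0}} (ε ^ n) {{ℚ.positive (^-positive n ε>0)}}}}

p+p≤q+q⇒p≤q : ∀ {p q} → p ℚ.+ p ℚ.≤ q ℚ.+ q → p ℚ.≤ q
p+p≤q+q⇒p≤q {p} {q} p+p≤q+q with p ℚ.≤? q
... | yes p≤q = p≤q
... | no  p≰q = contradiction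
  (ℚ.<-≤-trans (ℚ.+-mono-< (ℚ.≰⇒> p≰q) (ℚ.≰⇒> p≰q)) p+p≤q+q) (ℚ.<-irrefl refl)

sum-mono-≤ : ∀ {n} {f g : Vector ℚ n} → (∀ i → f i ℚ.≤ g i) → sum f ℚ.≤ sum g
sum-mono-≤ {zero}  f≤g = ℚ.≤-refl
sum-mono-≤ {suc n} f≤g = ℚ.+-mono-≤ (f≤g zero) (sum-mono-≤ (f≤g ∘ suc))

sum-nonNeg : ∀ {n} {f : Vector ℚ n} → (∀ i → 0ℚ ℚ.≤ f i) → 0ℚ ℚ.≤ sum f
sum-nonNeg {n} 0≤f = ℚ.≤-trans (ℚ.≤-reflexive (sym (sum-zero {n} (λ _ → refl)))) (sum-mono-≤ 0≤f)

form : ∀ {n} → Matrix ℚ n → Vector ℚ n → ℚ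
form A y = sum λ i → y i ℚ.* sum λ j → A i j ℚ.* y j

norm² : ∀ {n} → Vector ℚ n → ℚ
norm² y = sum λ i → y i ℚ.* y i

norm²-nonNeg : ∀ {n} (y : Vector ℚ n) → 0ℚ ℚ.≤ norm² y
norm²-nonNeg y = sum-nonNeg (λ i → 0≤p*p (y i))

-- Schur complements and definite forms

module SchurComplement {n} (A : Matrix ℚ (suc n)) .{{_ : ℚ.NonZero (A zero zero)}} where
  a = A zero zero

  multiplier : Vector ℚ n
  multiplier j = ℚ.- (ℚ.1/ a ℚ.* A zero (suc j))

  cleared : ∀ j → A zero (suc j) ℚ.+ multiplier j ℚ.* a ≡ 0ℚ
  cleared j = begin
    b ℚ.+ ℚ.- (ℚ.1/ a ℚ.* b) ℚ.* a    ≡⟨ regroup a b (ℚ.1/ a) ⟩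
    b ℚ.+ ℚ.- (a ℚ.* ℚ.1/ a ℚ.* b)    ≡⟨ cong (λ r → b ℚ.+ ℚ.- (r ℚ.* b)) (ℚ.*-inverseʳ a) ⟩
    b ℚ.+ ℚ.- (1ℚ ℚ.* b)              ≡⟨ cong (λ r → b ℚ.+ ℚ.- r) (ℚ.*-identityˡ b) ⟩
    b ℚ.+ ℚ.- b                       ≡⟨ ℚ.+-inverseʳ b ⟩
    0ℚ ∎
    where
    open ≡-Reasoning
    open +-*-Solver
    b = A zero (suc j)
    regroup : ∀ a b c → b ℚ.+ ℚ.- (c ℚ.* b) ℚ.* a ≡ b ℚ.+ ℚ.- (a ℚ.* c ℚ.* b)
    regroup = solve 3 (λ a b c → b :+ :- (c :* b) :* a := b :+ :- (a :* c :* b)) refl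

  -- The Schur complement D - c b / a, where `A` has corner a, rest of the first row b, rest of the
  -- first column c and remaining block D.
  complement : Matrix ℚ n
  complement i j = A (suc i) (suc j) ℚ.+ multiplier j ℚ.* A (suc i) zero

  det-complement : Detℚ.det A ≡ a ℚ.* Detℚ.det complement
  det-complement = det-pivot A multiplier cleared

  -- The new coordinate is the one that makes the first entry of `A` times the extended vector zero.
  extend : Vector ℚ n → Vector ℚ (suc n)
  extend y = sum (λ j → multiplier j ℚ.* y j) ∷ y

  -- The first row contributes nothing by the choice of `extend`; in the other rows, substituting
  -- the new coordinate turns the block of `A` into the complement.
  form-complement : ∀ y → form complement y ≡ form A (extend y)
  form-complement y = sym (begin
    form A (extend y)                  ≡⟨ cong (λ r → z ℚ.* r ℚ.+ rest) first-row ⟩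
    z ℚ.* 0ℚ ℚ.+ rest                  ≡⟨ cong (ℚ._+ rest) (ℚ.*-zeroʳ z) ⟩
    0ℚ ℚ.+ rest                        ≡⟨ ℚ.+-identityˡ rest ⟩
    rest                               ≡⟨ sum-cong-≋ (λ i → cong (y i ℚ.*_) (other-row i)) ⟩
    form complement y                  ∎)
    where
    open ≡-Reasoning
    z = sum (λ j → multiplier j ℚ.* y j)
    rest = sum λ i → y i ℚ.* (A (suc i) zero ℚ.* z ℚ.+ sum λ j → A (suc i) (suc j) ℚ.* y j)

    -- Substitutes `z` into a row with first entry `c` and further entries `b`. The first row of `A`
    -- gets the coefficients that `cleared` kills, the others get rows of `complement`.
    combine : ∀ c (b : Vector ℚ n) → c ℚ.* z ℚ.+ sum (λ j → b j ℚ.* y j) ≡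
      sum (λ j → (b j ℚ.+ multiplier j ℚ.* c) ℚ.* y j)
    combine c b = begin
      c ℚ.* z ℚ.+ sum (λ j → b j ℚ.* y j)
        ≡⟨ ℚ.+-comm (c ℚ.* z) _ ⟩
      sum (λ j → b j ℚ.* y j) ℚ.+ c ℚ.* z
        ≡⟨ sum-linear (λ j → b j ℚ.* y j) c (λ j → multiplier j ℚ.* y j) ⟨
      sum (λ j → b j ℚ.* y j ℚ.+ c ℚ.* (multiplier j ℚ.* y j))
        ≡⟨ sum-cong-≋ (λ j → regroup (b j) c (multiplier j) (y j)) ⟩
      sum (λ j → (b j ℚ.+ multiplier j ℚ.* c) ℚ.* y j) ∎
      where
      open +-*-Solver
      regroup : ∀ b c t y → b ℚ.* y ℚ.+ c ℚ.* (t ℚ.* y) ≡ (b ℚ.+ t ℚ.* c) ℚ.* y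
      regroup = solve 4 (λ b c t y → b :* y :+ c :* (t :* y) := (b :+ t :* c) :* y) refl

    first-row : a ℚ.* z ℚ.+ sum (λ j → A zero (suc j) ℚ.* y j) ≡ 0ℚ
    first-row = trans (combine a (λ j → A zero (suc j)))
      (sum-zero λ j → trans (cong (ℚ._* y j) (cleared j)) (ℚ.*-zeroˡ (y j)))

    other-row : ∀ i → A (suc i) zero ℚ.* z ℚ.+ sum (λ j → A (suc i) (suc j) ℚ.* y j) ≡
      sum (λ j → complement i j ℚ.* y j)
    other-row i = combine (A (suc i) zero) (λ j → A (suc i) (suc j))

-- The absolute value covers both signs: the characteristic matrix is positive definite above the
-- interval and negative definite below it.
Definite : ∀ {n} → ℚ → Matrix ℚ n → Set
Definite ε A = ∀ y → ε ℚ.* norm² y ℚ.≤ ℚ.∣ form A y ∣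

unit : ∀ {n} → Vector ℚ (suc n)
unit = 1ℚ ∷ const 0ℚ

form-unit : ∀ {n} (A : Matrix ℚ (suc n)) → form A unit ≡ A zero zero
form-unit {n} A = begin
  form A unit
    ≡⟨ cong₂ (λ r s → 1ℚ ℚ.* (a ℚ.* 1ℚ ℚ.+ r) ℚ.+ s) first-row other-rows ⟩
  1ℚ ℚ.* (a ℚ.* 1ℚ ℚ.+ 0ℚ) ℚ.+ 0ℚ
    ≡⟨ solve 1 (λ a → con 1ℚ :* (a :* con 1ℚ :+ con 0ℚ) :+ con 0ℚ := a) refl a ⟩
  a ∎
  where
  open ≡-Reasoning
  open +-*-Solver
  a = A zero zero
  first-row : sum {n} (λ j → A zero (suc j) ℚ.* 0ℚ) ≡ 0ℚ
  first-row = sum-zero λ j → ℚ.*-zeroʳ (A zero (suc j))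
  other-rows : sum {n} (λ i → 0ℚ ℚ.* sum (λ j → A (suc i) j ℚ.* unit j)) ≡ 0ℚ
  other-rows = sum-zero λ i → ℚ.*-zeroˡ (sum λ j → A (suc i) j ℚ.* unit j)

norm²-unit : ∀ {n} → norm² (unit {n}) ≡ 1ℚ
norm²-unit {n} = cong (1ℚ ℚ.+_) (sum-zero {n} {λ _ → 0ℚ} (λ _ → refl))

-- The form at the first basis vector is the corner.
Definite⇒corner : ∀ {n ε} (A : Matrix ℚ (suc n)) → Definite ε A → ε ℚ.≤ ℚ.∣ A zero zero ∣
Definite⇒corner {n} {ε} A definite = begin
  ε                          ≡⟨ ℚ.*-identityʳ ε ⟨
  ε ℚ.* 1ℚ                   ≡⟨ cong (ε ℚ.*_) (norm²-unit {n}) ⟨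
  ε ℚ.* norm² (unit {n})     ≤⟨ definite unit ⟩
  ℚ.∣ form A unit ∣          ≡⟨ cong ℚ.∣_∣ (form-unit A) ⟩
  ℚ.∣ A zero zero ∣          ∎
  where open ℚ.≤-Reasoning

-- The corner is at least ε in absolute value, hence invertible, and the complement is definite with
-- the same ε because `extend` does not decrease the norm. The bound depends only on ε and the
-- order, so it is uniform along a sequence of matrices.
Definite⇒det : ∀ {n ε} (A : Matrix ℚ n) → 0ℚ ℚ.< ε → Definite ε A →
  ε ^ n ℚ.≤ ℚ.∣ Detℚ.det A ∣
Definite⇒det {zero} A ε>0 definite = ℚ.≤-refl
Definite⇒det {suc n} {ε} A ε>0 definite = begin
  ε ℚ.* ε ^ n
    ≤⟨ ℚ.*-monoʳ-≤-nonNeg (ε ^ n) {{ℚ.nonNegative (ℚ.<⇒≤ (^-positive n ε>0))}} corner ⟩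
  ℚ.∣ a ∣ ℚ.* ε ^ n
    ≤⟨ ℚ.*-monoˡ-≤-nonNeg ℚ.∣ a ∣ {{ℚ.∣-∣-nonNeg a}}
         (Definite⇒det complement ε>0 complement-definite) ⟩
  ℚ.∣ a ∣ ℚ.* ℚ.∣ Detℚ.det complement ∣  ≡⟨ ℚ.∣p*q∣≡∣p∣*∣q∣ a _ ⟨
  ℚ.∣ a ℚ.* Detℚ.det complement ∣        ≡⟨ cong ℚ.∣_∣ det-complement ⟨
  ℚ.∣ Detℚ.det A ∣                       ∎
  where
  open ℚ.≤-Reasoning
  corner : ε ℚ.≤ ℚ.∣ A zero zero ∣
  corner = Definite⇒corner A definite
  instance
    a-nonZero : ℚ.NonZero (A zero zero)
    a-nonZero = ℚ.≢-nonZero λ a≡0 →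
      ℚ.<-irrefl refl (ℚ.<-≤-trans ε>0 (ℚ.≤-trans corner (ℚ.≤-reflexive (cong ℚ.∣_∣ a≡0))))
  open SchurComplement A

  complement-definite : Definite ε complement
  complement-definite y = begin
    ε ℚ.* norm² y
      ≤⟨ ℚ.*-monoˡ-≤-nonNeg ε {{ℚ.nonNegative (ℚ.<⇒≤ ε>0)}} norm-≤ ⟩
    ε ℚ.* norm² (extend y)         ≤⟨ definite (extend y) ⟩
    ℚ.∣ form A (extend y) ∣        ≡⟨ cong ℚ.∣_∣ (form-complement y) ⟨
    ℚ.∣ form complement y ∣        ∎
    where
    norm-≤ : norm² y ℚ.≤ norm² (extend y)
    norm-≤ = begin
      norm² y            ≡⟨ ℚ.+-identityˡ (norm² y) ⟨
      0ℚ ℚ.+ norm² y     ≤⟨ ℚ.+-monoˡ-≤ (norm² y) (0≤p*p (sum λ j → multiplier j ℚ.* y j)) ⟩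
      norm² (extend y)   ∎

-- Weighted Laplacians

sum-single : ∀ {n} (f : Vector ℚ n) i → (∀ j → j ≢ i → f j ≡ 0ℚ) → sum f ≡ f i
sum-single {suc n} f i zeros = begin
  sum f                          ≡⟨ sum-remove {i = i} f ⟩
  f i ℚ.+ sum (removeAt f i)     ≡⟨ cong (f i ℚ.+_) (sum-zero λ j → zeros _ (Fin.punchInᵢ≢i i j)) ⟩
  f i ℚ.+ 0ℚ                     ≡⟨ ℚ.+-identityʳ (f i) ⟩
  f i                            ∎
  where open ≡-Reasoning

form-diag : ∀ {n} (v y : Vector ℚ n) → form (diag 0ℚ v) y ≡ sum (λ i → v i ℚ.* (y i ℚ.* y i))
form-diag {n} v y = sum-cong-≋ λ i → begin
  y i ℚ.* sum (λ j → diag 0ℚ v i j ℚ.* y j)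
    ≡⟨ cong (y i ℚ.*_) (sum-single (λ j → diag 0ℚ v i j ℚ.* y j) i (off i)) ⟩
  y i ℚ.* (diag 0ℚ v i i ℚ.* y i)
    ≡⟨ cong (λ r → y i ℚ.* (r ℚ.* y i)) (on i) ⟩
  y i ℚ.* (v i ℚ.* y i)
    ≡⟨ regroup (v i) (y i) ⟩
  v i ℚ.* (y i ℚ.* y i) ∎
  where
  open ≡-Reasoning
  open +-*-Solver
  regroup : ∀ v y → y ℚ.* (v ℚ.* y) ≡ v ℚ.* (y ℚ.* y)
  regroup = solve 2 (λ v y → y :* (v :* y) := v :* (y :* y)) refl
  on : ∀ i → diag 0ℚ v i i ≡ v i
  on i with i Fin.≟ i
  ... | yes _  = refl
  ... | no i≢i = contradiction refl i≢i
  off : ∀ i j → j ≢ i → diag 0ℚ v i j ℚ.* y j ≡ 0ℚ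
  off i j j≢i with i Fin.≟ j
  ... | yes i≡j = contradiction (sym i≡j) j≢i
  ... | no  _   = ℚ.*-zeroˡ (y j)

form-sub : ∀ {n} (A B : Matrix ℚ n) y →
  form (λ i j → A i j ℚ.- B i j) y ≡ form A y ℚ.- form B y
form-sub {n} A B y = begin
  form (λ i j → A i j ℚ.- B i j) y
    ≡⟨ sum-cong-≋ (λ i → cong (y i ℚ.*_) (trans
         (sum-cong-≋ λ j → inner (A i j) (B i j) (y j))
         (sum-linear (λ j → A i j ℚ.* y j) (ℚ.- 1ℚ) (λ j → B i j ℚ.* y j)))) ⟩
  sum (λ i → y i ℚ.* (row A i ℚ.+ ℚ.- 1ℚ ℚ.* row B i))
    ≡⟨ sum-cong-≋ (λ i → outer (row A i) (row B i) (y i)) ⟩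
  sum (λ i → y i ℚ.* row A i ℚ.+ ℚ.- 1ℚ ℚ.* (y i ℚ.* row B i))
    ≡⟨ sum-linear (λ i → y i ℚ.* row A i) (ℚ.- 1ℚ) (λ i → y i ℚ.* row B i) ⟩
  form A y ℚ.+ ℚ.- 1ℚ ℚ.* form B y
    ≡⟨ solve 2 (λ a b → a :+ con (ℚ.- 1ℚ) :* b := a :- b) refl (form A y) (form B y) ⟩
  form A y ℚ.- form B y ∎
  where
  open ≡-Reasoning
  open +-*-Solver
  row : Matrix ℚ n → Fin n → ℚ
  row C i = sum λ j → C i j ℚ.* y j
  inner : ∀ a b y → (a ℚ.- b) ℚ.* y ≡ a ℚ.* y ℚ.+ ℚ.- 1ℚ ℚ.* (b ℚ.* y)
  inner = solve 3 (λ a b y → (a :- b) :* y := a :* y :+ con (ℚ.- 1ℚ) :* (b :* y)) refl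
  outer : ∀ a b y → y ℚ.* (a ℚ.+ ℚ.- 1ℚ ℚ.* b) ≡ y ℚ.* a ℚ.+ ℚ.- 1ℚ ℚ.* (y ℚ.* b)
  outer = solve 3 (λ a b y →
    y :* (a :+ con (ℚ.- 1ℚ) :* b) := y :* a :+ con (ℚ.- 1ℚ) :* (y :* b)) refl

∑∑ : ∀ {n} → Matrix ℚ n → ℚ
∑∑ f = sum λ i → sum (f i)

∑∑-cong : ∀ {n} {f g : Matrix ℚ n} → (∀ i j → f i j ≡ g i j) → ∑∑ f ≡ ∑∑ g
∑∑-cong f≡g = sum-cong-≋ λ i → sum-cong-≋ (f≡g i)

∑∑-linear : ∀ {n} (f : Matrix ℚ n) t g →
  ∑∑ (λ i j → f i j ℚ.+ t ℚ.* g i j) ≡ ∑∑ f ℚ.+ t ℚ.* ∑∑ g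
∑∑-linear f t g = trans (sum-cong-≋ λ i → sum-linear (f i) t (g i))
  (sum-linear (λ i → sum (f i)) t (λ i → sum (g i)))

∑∑-mono-≤ : ∀ {n} {f g : Matrix ℚ n} → (∀ i j → f i j ℚ.≤ g i j) → ∑∑ f ℚ.≤ ∑∑ g
∑∑-mono-≤ f≤g = sum-mono-≤ λ i → sum-mono-≤ (f≤g i)

-- Degrees are column sums, matching `transmission`. A diagonal weight cancels against its share of
-- the degree, so a constant weight on all pairs, diagonal included, gives the complete graph.
laplacian : ∀ {n} → Matrix ℚ n → Matrix ℚ n
laplacian w i j = diag 0ℚ (λ v → sum λ u → w u v) i j ℚ.- w i j

form-laplacian : ∀ {n} (w : Matrix ℚ n) y →
  form (laplacian w) y ≡ sum (λ i → sum (λ u → w u i) ℚ.* (y i ℚ.* y i)) ℚ.- form w y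
form-laplacian w y = trans (form-sub (diag 0ℚ degree) w y)
  (cong (ℚ._- form w y) (form-diag degree y))
  where
  degree : Vector ℚ _
  degree v = sum λ u → w u v

-- Twice the usual sum of w u v (y u - y v)² over unordered pairs, as ∑∑ meets each pair twice.
form-laplacian-double : ∀ {n} (w : Matrix ℚ n) → (∀ i j → w i j ≡ w j i) → ∀ y →
  form (laplacian w) y ℚ.+ form (laplacian w) y ≡
  ∑∑ (λ i j → w i j ℚ.* ((y i ℚ.- y j) ℚ.* (y i ℚ.- y j)))
form-laplacian-double w w-sym y = begin
  form (laplacian w) y ℚ.+ form (laplacian w) y
    ≡⟨ cong (λ r → r ℚ.+ r) (trans (form-laplacian w y) (cong₂ ℚ._-_ by-column form-∑∑)) ⟩
  (X ℚ.- Z) ℚ.+ (X ℚ.- Z)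
    -- Only one copy of `X` is exchanged for `Y`, so that both outer terms of the square of
    -- `y i - y j` appear.
    ≡⟨ cong (λ r → (X ℚ.- Z) ℚ.+ (r ℚ.- Z)) by-row ⟩
  (X ℚ.- Z) ℚ.+ (Y ℚ.- Z)
    ≡⟨ regroup X Y Z ⟩
  (X ℚ.+ 1ℚ ℚ.* Y) ℚ.+ (ℚ.- (1ℚ ℚ.+ 1ℚ)) ℚ.* Z
    ≡⟨ cong (ℚ._+ (ℚ.- (1ℚ ℚ.+ 1ℚ)) ℚ.* Z) (∑∑-linear x 1ℚ x′) ⟨
  ∑∑ (λ i j → x i j ℚ.+ 1ℚ ℚ.* x′ i j) ℚ.+ (ℚ.- (1ℚ ℚ.+ 1ℚ)) ℚ.* Z
    ≡⟨ ∑∑-linear (λ i j → x i j ℚ.+ 1ℚ ℚ.* x′ i j) (ℚ.- (1ℚ ℚ.+ 1ℚ)) z ⟨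
  ∑∑ (λ i j → (x i j ℚ.+ 1ℚ ℚ.* x′ i j) ℚ.+ (ℚ.- (1ℚ ℚ.+ 1ℚ)) ℚ.* z i j)
    ≡⟨ ∑∑-cong (λ i j → square (w i j) (y i) (y j)) ⟩
  ∑∑ (λ i j → w i j ℚ.* ((y i ℚ.- y j) ℚ.* (y i ℚ.- y j))) ∎
  where
  open ≡-Reasoning
  open +-*-Solver
  x x′ z : Matrix ℚ _
  x  i j = w i j ℚ.* (y i ℚ.* y i)
  x′ i j = w i j ℚ.* (y j ℚ.* y j)
  z  i j = y i ℚ.* (w i j ℚ.* y j)
  X = ∑∑ x
  Y = ∑∑ x′
  Z = ∑∑ z
  form-∑∑ : form w y ≡ Z
  form-∑∑ = sum-cong-≋ λ i → *-distribˡ-sum (y i) (λ j → w i j ℚ.* y j)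
  by-column : sum (λ i → sum (λ u → w u i) ℚ.* (y i ℚ.* y i)) ≡ X
  by-column = sum-cong-≋ λ i → trans (*-distribʳ-sum (y i ℚ.* y i) (λ u → w u i))
    (sum-cong-≋ λ u → cong (ℚ._* (y i ℚ.* y i)) (w-sym u i))
  by-row : X ≡ Y
  by-row = trans (∑-comm x) (∑∑-cong λ i j → cong (ℚ._* (y j ℚ.* y j)) (w-sym j i))
  regroup : ∀ X Y Z → (X ℚ.- Z) ℚ.+ (Y ℚ.- Z) ≡
    (X ℚ.+ 1ℚ ℚ.* Y) ℚ.+ (ℚ.- (1ℚ ℚ.+ 1ℚ)) ℚ.* Z
  regroup = solve 3 (λ X Y Z → (X :- Z) :+ (Y :- Z) :=
    (X :+ con 1ℚ :* Y) :+ con (ℚ.- (1ℚ ℚ.+ 1ℚ)) :* Z) refl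
  square : ∀ w a b →
    (w ℚ.* (a ℚ.* a) ℚ.+ 1ℚ ℚ.* (w ℚ.* (b ℚ.* b))) ℚ.+ (ℚ.- (1ℚ ℚ.+ 1ℚ)) ℚ.* (a ℚ.* (w ℚ.* b))
    ≡ w ℚ.* ((a ℚ.- b) ℚ.* (a ℚ.- b))
  square = solve 3 (λ w a b →
    (w :* (a :* a) :+ con 1ℚ :* (w :* (b :* b))) :+ con (ℚ.- (1ℚ ℚ.+ 1ℚ)) :* (a :* (w :* b))
    := w :* ((a :- b) :* (a :- b))) refl

-- In the doubled form each weight multiplies a square, so the comparison is made weight by weight.
laplacian-mono-≤ : ∀ {n} {w w′ : Matrix ℚ n} →
  (∀ i j → w i j ≡ w j i) → (∀ i j → w′ i j ≡ w′ j i) →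
  (∀ i j → w i j ℚ.≤ w′ i j) → ∀ y → form (laplacian w) y ℚ.≤ form (laplacian w′) y
laplacian-mono-≤ {w = w} {w′} w-sym w′-sym w≤w′ y = p+p≤q+q⇒p≤q (begin
  form (laplacian w) y ℚ.+ form (laplacian w) y
    ≡⟨ form-laplacian-double w w-sym y ⟩
  ∑∑ (λ i j → w i j ℚ.* ((y i ℚ.- y j) ℚ.* (y i ℚ.- y j)))
    ≤⟨ ∑∑-mono-≤ (λ i j → ℚ.*-monoʳ-≤-nonNeg ((y i ℚ.- y j) ℚ.* (y i ℚ.- y j))
         {{ℚ.nonNegative (0≤p*p (y i ℚ.- y j))}} (w≤w′ i j)) ⟩
  ∑∑ (λ i j → w′ i j ℚ.* ((y i ℚ.- y j) ℚ.* (y i ℚ.- y j)))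
    ≡⟨ form-laplacian-double w′ w′-sym y ⟨
  form (laplacian w′) y ℚ.+ form (laplacian w′) y ∎)
  where open ℚ.≤-Reasoning

form-const : ∀ {n} c (y : Vector ℚ n) → form (λ _ _ → c) y ≡ c ℚ.* (sum y ℚ.* sum y)
form-const c y = begin
  form (λ _ _ → c) y                ≡⟨ sum-cong-≋ (λ i → cong (y i ℚ.*_) (*-distribˡ-sum c y)) ⟨
  sum (λ i → y i ℚ.* (c ℚ.* sum y)) ≡⟨ *-distribʳ-sum (c ℚ.* sum y) y ⟨
  sum y ℚ.* (c ℚ.* sum y)
    ≡⟨ solve 2 (λ c s → s :* (c :* s) := c :* (s :* s)) refl c (sum y) ⟩
  c ℚ.* (sum y ℚ.* sum y)           ∎
  where
  open ≡-Reasoning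
  open +-*-Solver

laplacian-nonNeg : ∀ {n} {w : Matrix ℚ n} → (∀ i j → w i j ≡ w j i) →
  (∀ i j → 0ℚ ℚ.≤ w i j) → ∀ y → 0ℚ ℚ.≤ form (laplacian w) y
laplacian-nonNeg {w = w} w-sym 0≤w y = p+p≤q+q⇒p≤q (begin
  0ℚ
    ≤⟨ sum-nonNeg (λ i → sum-nonNeg λ j → ℚ.nonNegative⁻¹ _
         {{ℚ.nonNeg*nonNeg⇒nonNeg (w i j) {{ℚ.nonNegative (0≤w i j)}} _
           {{ℚ.nonNegative (0≤p*p (y i ℚ.- y j))}}}}) ⟩
  ∑∑ (λ i j → w i j ℚ.* ((y i ℚ.- y j) ℚ.* (y i ℚ.- y j)))
    ≡⟨ form-laplacian-double w w-sym y ⟨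
  form (laplacian w) y ℚ.+ form (laplacian w) y ∎)
  where open ℚ.≤-Reasoning

-- Comparison with the complete graph with all weights c, whose Laplacian is c (n I - J).
laplacian-≤ : ∀ {n} {w : Matrix ℚ n} → (∀ i j → w i j ≡ w j i) →
  ∀ {c} → 0ℚ ℚ.≤ c → (∀ i j → w i j ℚ.≤ c) → ∀ y →
  form (laplacian w) y ℚ.≤ sum {n} (const c) ℚ.* norm² y
laplacian-≤ {n} {w} w-sym {c} 0≤c w≤c y = begin
  form (laplacian w) y
    ≤⟨ laplacian-mono-≤ w-sym (λ _ _ → refl) w≤c y ⟩
  form (laplacian (λ _ _ → c)) y
    ≡⟨ form-laplacian (λ _ _ → c) y ⟩
  weighted ℚ.- form (λ _ _ → c) y
    ≤⟨ ℚ.+-monoʳ-≤ weighted (ℚ.neg-antimono-≤ 0≤form) ⟩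
  weighted ℚ.+ 0ℚ
    ≡⟨ ℚ.+-identityʳ weighted ⟩
  weighted
    ≡⟨ *-distribˡ-sum (sum {n} (const c)) (λ i → y i ℚ.* y i) ⟨
  sum {n} (const c) ℚ.* norm² y ∎
  where
  open ℚ.≤-Reasoning
  weighted : ℚ
  weighted = sum λ i → sum {n} (const c) ℚ.* (y i ℚ.* y i)
  0≤form : 0ℚ ℚ.≤ form (λ _ _ → c) y
  0≤form = ℚ.≤-trans (ℚ.nonNegative⁻¹ _ {{ℚ.nonNeg*nonNeg⇒nonNeg c {{ℚ.nonNegative 0≤c}} _
    {{ℚ.nonNegative (0≤p*p (sum y))}}}}) (ℚ.≤-reflexive (sym (form-const c y)))

-- Characteristic matrices beyond the bounds of a form

charMatrix : ∀ {n} → Matrix ℚ n → ℚ → Matrix ℚ n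
charMatrix A x i j = diag 0ℚ (const x) i j ℚ.- A i j

form-charMatrix : ∀ {n} (A : Matrix ℚ n) x y →
  form (charMatrix A x) y ≡ x ℚ.* norm² y ℚ.- form A y
form-charMatrix A x y = trans (form-sub (diag 0ℚ (const x)) A y)
  (cong (ℚ._- form A y) (trans (form-diag (const x) y)
    (sym (*-distribˡ-sum x (λ i → y i ℚ.* y i)))))

p≤∣p∣ : ∀ p → p ℚ.≤ ℚ.∣ p ∣
p≤∣p∣ p with ℚ.≤-total 0ℚ p
... | inj₁ 0≤p = ℚ.≤-reflexive (sym (ℚ.0≤p⇒∣p∣≡p 0≤p))
... | inj₂ p≤0 = ℚ.≤-trans p≤0 (ℚ.0≤∣p∣ p)

-- Here x |y|² exceeds the form of `A` by at least ε |y|², so the form of the characteristic matrix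
-- is positive and equals its absolute value up to the estimate needed.
Definite-above : ∀ {n} {A : Matrix ℚ n} {b x ε} →
  (∀ y → form A y ℚ.≤ b ℚ.* norm² y) → b ℚ.+ ε ℚ.≤ x → Definite ε (charMatrix A x)
Definite-above {A = A} {b} {x} {ε} A≤b b+ε≤x y = begin
  ε ℚ.* N                              ≡⟨ regroup b ε N ⟩
  (b ℚ.+ ε) ℚ.* N ℚ.- b ℚ.* N
    ≤⟨ ℚ.+-mono-≤ (ℚ.*-monoʳ-≤-nonNeg N {{ℚ.nonNegative (norm²-nonNeg y)}} b+ε≤x)
                  (ℚ.neg-antimono-≤ (A≤b y)) ⟩
  x ℚ.* N ℚ.- form A y                 ≡⟨ form-charMatrix A x y ⟨
  form (charMatrix A x) y              ≤⟨ p≤∣p∣ _ ⟩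
  ℚ.∣ form (charMatrix A x) y ∣        ∎
  where
  open ℚ.≤-Reasoning
  open +-*-Solver
  N = norm² y
  regroup : ∀ b ε N → ε ℚ.* N ≡ (b ℚ.+ ε) ℚ.* N ℚ.- b ℚ.* N
  regroup = solve 3 (λ b ε N → ε :* N := (b :+ ε) :* N :- b :* N) refl

-- The mirror image of `Definite-above`: the negated form of the characteristic matrix is at least
-- -x |y|², hence at least ε |y|².
Definite-below : ∀ {n} {A : Matrix ℚ n} {x ε} →
  (∀ y → 0ℚ ℚ.≤ form A y) → x ℚ.+ ε ℚ.≤ 0ℚ → Definite ε (charMatrix A x)
Definite-below {A = A} {x} {ε} 0≤A x+ε≤0 y = begin
  ε ℚ.* N                              ≡⟨ regroup x ε N ⟩
  (x ℚ.+ ε) ℚ.* N ℚ.- x ℚ.* N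
    ≤⟨ ℚ.+-monoˡ-≤ (ℚ.- (x ℚ.* N))
         (ℚ.*-monoʳ-≤-nonNeg N {{ℚ.nonNegative (norm²-nonNeg y)}} x+ε≤0) ⟩
  0ℚ ℚ.* N ℚ.- x ℚ.* N                 ≡⟨ cong (ℚ._- x ℚ.* N) (ℚ.*-zeroˡ N) ⟩
  0ℚ ℚ.- x ℚ.* N                       ≤⟨ ℚ.+-monoˡ-≤ (ℚ.- (x ℚ.* N)) (0≤A y) ⟩
  form A y ℚ.- x ℚ.* N                 ≡⟨ negate (form A y) (x ℚ.* N) ⟩
  ℚ.- (x ℚ.* N ℚ.- form A y)           ≡⟨ cong ℚ.-_ (form-charMatrix A x y) ⟨
  ℚ.- form (charMatrix A x) y          ≤⟨ p≤∣p∣ _ ⟩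
  ℚ.∣ ℚ.- form (charMatrix A x) y ∣    ≡⟨ ℚ.∣-p∣≡∣p∣ _ ⟩
  ℚ.∣ form (charMatrix A x) y ∣        ∎
  where
  open ℚ.≤-Reasoning
  open +-*-Solver
  N = norm² y
  regroup : ∀ x ε N → ε ℚ.* N ≡ (x ℚ.+ ε) ℚ.* N ℚ.- x ℚ.* N
  regroup = solve 3 (λ x ε N → ε :* N := (x :+ ε) :* N :- x :* N) refl
  negate : ∀ a b → a ℚ.- b ≡ ℚ.- (b ℚ.- a)
  negate = solve 2 (λ a b → a :- b := :- (b :- a)) refl

-- Real eigenvalues through rational approximations

open RawRing ℝ-rawRing using () renaming
  ( _+_ to _+ᴿ_; _*_ to _*ᴿ_; -_ to -ᴿ_; 0# to 0ᴿ
  ; +-rawMonoid to +ᴿ-rawMonoid; *-rawMonoid to *ᴿ-rawMonoid )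

seq-sum : ∀ {n} (f : Vector ℝ n) k →
  seq (RawSum.sum +ᴿ-rawMonoid f) k ≡ sum (λ i → seq (f i) k)
seq-sum {zero}  f k = refl
seq-sum {suc n} f k = cong (seq (f zero) k ℚ.+_) (seq-sum (f ∘ suc) k)

seq--1^ : ∀ m x k → seq (Det.-1^_·_ ℝ-rawRing m x) k ≡ Detℚ.-1^ m · seq x k
seq--1^ zero    x k = refl
seq--1^ (suc m) x k = cong ℚ.-_ (seq--1^ m x k)

seq-det : ∀ {n} (A : Matrix ℝ n) k → seq (det A) k ≡ Detℚ.det (λ i j → seq (A i j) k)
seq-det {zero}  A k = refl
seq-det {suc n} A k = trans (seq-sum (λ j → Det.-1^_·_ ℝ-rawRing (toℕ j) (product j)) k)
  (sum-cong-≋ λ j → trans (seq--1^ (toℕ j) (product j) k)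
    (cong (λ r → Detℚ.-1^ toℕ j · (seq (A zero j) k ℚ.* r))
      (seq-det (λ i → removeAt (A (suc i)) j) k)))
  where
  product : Fin (suc n) → ℝ
  product j = A zero j *ᴿ det (λ i → removeAt (A (suc i)) j)

-- Real ring operations act termwise on sequences, so each term of a real characteristic polynomial
-- value is a rational one.
seq-charPoly : ∀ {n} (A : Matrix ℝ n) x k →
  seq (charPoly A x) k ≡ Detℚ.det (charMatrix (λ i j → seq (A i j) k) (seq x k))
seq-charPoly A x k =
  trans (seq-det (λ i j → diag 0ᴿ (const x) i j +ᴿ -ᴿ A i j) k) (det-cong entry)
  where
  entry : ∀ i j → seq (diag 0ᴿ (const x) i j +ᴿ -ᴿ A i j) k ≡
    charMatrix (λ i j → seq (A i j) k) (seq x k) i j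
  entry i j with i Fin.≟ j
  ... | yes _ = refl
  ... | no  _ = refl

seq-product-zero : ∀ {n} (f : Vector ℝ n) k i → seq (f i) k ≡ 0ℚ →
  seq (RawSum.sum *ᴿ-rawMonoid f) k ≡ 0ℚ
seq-product-zero {suc n} f k zero eq = trans
  (cong (ℚ._* rest) eq) (ℚ.*-zeroˡ rest)
  where
  rest : ℚ
  rest = seq (RawSum.sum *ᴿ-rawMonoid (f ∘ suc)) k
seq-product-zero {suc n} f k (suc i) eq = trans
  (cong (seq (f zero) k ℚ.*_) (seq-product-zero (f ∘ suc) k i eq)) (ℚ.*-zeroʳ (seq (f zero) k))

-- At `λs i` the product contains the factor `λs i` minus itself, which is exactly zero at every
-- index. Closeness to the product is therefore smallness of the rational determinants.
charPoly-eigenvalue : ∀ {n} {A : Matrix ℝ n} {λs : Vector ℝ n} →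
  Eigenvalues A λs → ∀ i {ε} → 0ℚ ℚ.< ε →
  ∃[ N ] (∀ {k} → N ℕ.≤ k →
    ℚ.∣ Detℚ.det (charMatrix (λ i j → seq (A i j) k) (seq (λs i) k)) ∣ ℚ.< ε)
charPoly-eigenvalue {A = A} {λs} eigenvalues i {ε} ε>0 with eigenvalues (λs i) ε>0
... | N , close = N , λ {k} N≤k → subst (ℚ._< ε) (cong ℚ.∣_∣ (value k)) (close N≤k)
  where
  open ≡-Reasoning
  factors : Vector ℝ _
  factors j = λs i +ᴿ -ᴿ λs j
  value : ∀ k → seq (charPoly A (λs i)) k ℚ.- seq (RawSum.sum *ᴿ-rawMonoid factors) k ≡
    Detℚ.det (charMatrix (λ i j → seq (A i j) k) (seq (λs i) k))
  value k = begin
    seq (charPoly A (λs i)) k ℚ.- seq (RawSum.sum *ᴿ-rawMonoid factors) k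
      ≡⟨ cong₂ ℚ._-_ (seq-charPoly A (λs i) k)
           (seq-product-zero factors k i (ℚ.+-inverseʳ (seq (λs i) k))) ⟩
    Detℚ.det (charMatrix (λ i j → seq (A i j) k) (seq (λs i) k)) ℚ.+ 0ℚ
      ≡⟨ ℚ.+-identityʳ _ ⟩
    Detℚ.det (charMatrix (λ i j → seq (A i j) k) (seq (λs i) k)) ∎

-- The entries of `A` are constant sequences, so only the eigenvalue is approximated. The tolerance
-- ε^n is the lower bound that definiteness would force on the determinant.
eventually-indefinite : ∀ {n} {A : Matrix ℚ n} {λs : Vector ℝ n} →
  Eigenvalues (λ i j → ℚ→ℝ (A i j)) λs → ∀ i {ε} → 0ℚ ℚ.< ε →
  ∃[ N ] (∀ {k} → N ℕ.≤ k → ¬ Definite ε (charMatrix A (seq (λs i) k)))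
eventually-indefinite {n} eigenvalues i ε>0
  with charPoly-eigenvalue eigenvalues i (^-positive n ε>0)
... | N , small = N , λ N≤k definite →
  ℚ.<-irrefl refl (ℚ.≤-<-trans (Definite⇒det _ ε>0 definite) (small N≤k))

-- Since the order on ℚ is decidable, it suffices to refute that a late approximation lies more than
-- ε below zero; there the characteristic matrix would be definite.
eigenvalue-≥0 : ∀ {n} {A : Matrix ℚ n} {λs : Vector ℝ n} →
  Eigenvalues (λ i j → ℚ→ℝ (A i j)) λs → (∀ y → 0ℚ ℚ.≤ form A y) →
  ∀ i → ℚ→ℝ 0ℚ ≤ℝ λs i
eigenvalue-≥0 {A = A} {λs} eigenvalues 0≤A i {ε} ε>0
  with eventually-indefinite {A = A} eigenvalues i ε>0
... | N , indefinite = N , λ {k} N≤k → ℚ.≮⇒≥ λ below →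
  indefinite N≤k (Definite-below {A = A} 0≤A (ℚ.<⇒≤ below))

eigenvalue-≤ : ∀ {n} {A : Matrix ℚ n} {λs : Vector ℝ n} {b} →
  Eigenvalues (λ i j → ℚ→ℝ (A i j)) λs → (∀ y → form A y ℚ.≤ b ℚ.* norm² y) →
  ∀ i → λs i ≤ℝ ℚ→ℝ b
eigenvalue-≤ {A = A} {λs} {b} eigenvalues A≤b i {ε} ε>0
  with eventually-indefinite {A = A} eigenvalues i ε>0
... | N , indefinite = N , λ {k} N≤k → ℚ.≮⇒≥ λ above →
  indefinite N≤k (Definite-above {A = A} {b = b} A≤b (ℚ.<⇒≤ above))

-- Integers in ℚ

-- Proved on unnormalised fractions, where no gcd intervenes and the sum over denominator 1 computes
-- up to factors of 1 in the numerator.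
/1-+ : ∀ a b → (a ℤ.+ b) ℚ./ 1 ≡ a ℚ./ 1 ℚ.+ b ℚ./ 1
/1-+ a b = ℚ.toℚᵘ-injective (begin-equality
  ℚ.toℚᵘ ((a ℤ.+ b) ℚ./ 1)                     ≃⟨ ℚ.toℚᵘ-fromℚᵘ (ℚᵘ.mkℚᵘ (a ℤ.+ b) 0) ⟩
  ℚᵘ.mkℚᵘ (a ℤ.+ b) 0
    ≡⟨ cong (λ z → ℚᵘ.mkℚᵘ z 0) (cong₂ ℤ._+_ (sym (ℤ.*-identityʳ a)) (sym (ℤ.*-identityʳ b))) ⟩
  ℚᵘ.mkℚᵘ a 0 ℚᵘ.+ ℚᵘ.mkℚᵘ b 0
    ≃⟨ ℚᵘ.+-cong (ℚ.toℚᵘ-fromℚᵘ (ℚᵘ.mkℚᵘ a 0)) (ℚ.toℚᵘ-fromℚᵘ (ℚᵘ.mkℚᵘ b 0)) ⟨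
  ℚ.toℚᵘ (a ℚ./ 1) ℚᵘ.+ ℚ.toℚᵘ (b ℚ./ 1)       ≃⟨ ℚ.toℚᵘ-homo-+ (a ℚ./ 1) (b ℚ./ 1) ⟨
  ℚ.toℚᵘ (a ℚ./ 1 ℚ.+ b ℚ./ 1)                 ∎)
  where open ℚᵘ.≤-Reasoning

/1-neg : ∀ a → (ℤ.- a) ℚ./ 1 ≡ ℚ.- (a ℚ./ 1)
/1-neg a = ℚ.toℚᵘ-injective (begin-equality
  ℚ.toℚᵘ ((ℤ.- a) ℚ./ 1)        ≃⟨ ℚ.toℚᵘ-fromℚᵘ (ℚᵘ.mkℚᵘ (ℤ.- a) 0) ⟩
  ℚᵘ.- ℚᵘ.mkℚᵘ a 0              ≃⟨ ℚᵘ.-‿cong (ℚ.toℚᵘ-fromℚᵘ (ℚᵘ.mkℚᵘ a 0)) ⟨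
  ℚᵘ.- ℚ.toℚᵘ (a ℚ./ 1)         ≃⟨ ℚ.toℚᵘ-homo‿- (a ℚ./ 1) ⟨
  ℚ.toℚᵘ (ℚ.- (a ℚ./ 1))        ∎)
  where open ℚᵘ.≤-Reasoning

ℕ→ℚ : ℕ → ℚ
ℕ→ℚ m = ℤ.+ m ℚ./ 1

ℕ→ℚ-nonNeg : ∀ m → 0ℚ ℚ.≤ ℕ→ℚ m
ℕ→ℚ-nonNeg m = ℚ.nonNegative⁻¹ _ {{ℚ.normalize-nonNeg m 1}}

ℕ→ℚ-mono-≤ : ∀ {m n} → m ℕ.≤ n → ℕ→ℚ m ℚ.≤ ℕ→ℚ n
ℕ→ℚ-mono-≤ {m} {n} m≤n = begin
  ℕ→ℚ m                        ≡⟨ ℚ.+-identityʳ (ℕ→ℚ m) ⟨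
  ℕ→ℚ m ℚ.+ 0ℚ                 ≤⟨ ℚ.+-monoʳ-≤ (ℕ→ℚ m) (ℕ→ℚ-nonNeg (n ℕ.∸ m)) ⟩
  ℕ→ℚ m ℚ.+ ℕ→ℚ (n ℕ.∸ m)      ≡⟨ /1-+ (ℤ.+ m) (ℤ.+ (n ℕ.∸ m)) ⟨
  ℕ→ℚ (m + (n ℕ.∸ m))          ≡⟨ cong ℕ→ℚ (ℕ.m+[n∸m]≡n m≤n) ⟩
  ℕ→ℚ n                        ∎
  where open ℚ.≤-Reasoning

ℕ→ℚ-sum : ∀ {n} (f : Vector ℕ n) →
  ℕ→ℚ (RawSum.sum ℕ.+-0-rawMonoid f) ≡ sum (λ i → ℕ→ℚ (f i))
ℕ→ℚ-sum {zero}  f = refl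
ℕ→ℚ-sum {suc n} f = trans (/1-+ (ℤ.+ f zero) (ℤ.+ RawSum.sum ℕ.+-0-rawMonoid (f ∘ suc)))
  (cong (ℕ→ℚ (f zero) ℚ.+_) (ℕ→ℚ-sum (f ∘ suc)))

sum-const : ∀ n c → RawSum.sum ℕ.+-0-rawMonoid {n} (const c) ≡ n * c
sum-const zero    c = refl
sum-const (suc n) c = cong (c +_) (sum-const n c)

-- The left side is `distanceLaplacian` with an arbitrary `w` in place of the distance, which makes
-- the theory of weighted Laplacians over ℚ available.
/1-laplacian : ∀ {n} (w : Matrix ℕ n) i j →
  (diag (ℤ.+ 0) (λ v → ℤ.+ RawSum.sum ℕ.+-0-rawMonoid (λ u → w u v)) i j ℤ.- ℤ.+ w i j) ℚ./ 1
  ≡ laplacian (λ u v → ℕ→ℚ (w u v)) i j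
/1-laplacian w i j = trans
  (/1-+ (diag (ℤ.+ 0) (λ v → ℤ.+ degree v) i j) (ℤ.- ℤ.+ w i j))
  (cong₂ ℚ._+_ diagonal (/1-neg (ℤ.+ w i j)))
  where
  degree : Vector ℕ _
  degree v = RawSum.sum ℕ.+-0-rawMonoid (λ u → w u v)
  diagonal : diag (ℤ.+ 0) (λ v → ℤ.+ degree v) i j ℚ./ 1 ≡
    diag 0ℚ (λ v → sum λ u → ℕ→ℚ (w u v)) i j
  diagonal with i Fin.≟ j
  ... | yes _ = ℕ→ℚ-sum (λ u → w u i)
  ... | no  _ = refl

-- Distances in graphs

opposite-inject₁ : ∀ {n} (i : Fin n) → opposite (inject₁ i) ≡ suc (opposite i)
opposite-inject₁ zero    = refl
opposite-inject₁ (suc i) = cong inject₁ (opposite-inject₁ i)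

opposite-fromℕ : ∀ n → opposite (fromℕ n) ≡ zero
opposite-fromℕ zero    = refl
opposite-fromℕ (suc n) = cong inject₁ (opposite-fromℕ n)

module _ {n : ℕ} (G : Graph n) where
  open Graph G

  -- Reads the vertices through `opposite`, which sends step `i` to step `opposite i` run backwards;
  -- adjacency is symmetric.
  IsPath-reverse : ∀ {u v k} {p} → IsPath G u v {k} p →
    IsPath G v u {k} (tabulate (lookup p ∘ opposite))
  IsPath-reverse {k = k} {p} (mkPath start end step distinct) = mkPath
    -- `opposite zero` computes to `fromℕ k`, so the old endpoint is the new start without
    -- rewriting.
    end
    (trans (at (fromℕ k)) (trans (cong (lookup p) (opposite-fromℕ k)) start))
    (λ i → subst₂ Adj
      (sym (trans (at (inject₁ i)) (cong (lookup p) (opposite-inject₁ i))))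
      (sym (at (suc i)))
      (symm (step (opposite i))))
    (λ i j eq → opposite-injective (distinct _ _ (trans (sym (at i)) (trans eq (at j)))))
    where
    at : ∀ i → lookup (tabulate (lookup p ∘ opposite)) i ≡ lookup p (opposite i)
    at = lookup∘tabulate (lookup p ∘ opposite)
    opposite-injective : ∀ {i j : Fin (suc k)} → opposite i ≡ opposite j → i ≡ j
    opposite-injective {i} {j} eq = trans (sym (Fin.opposite-involutive i))
      (trans (cong opposite eq) (Fin.opposite-involutive j))

  HasPath-reverse : ∀ {u v k} → HasPath G u v k → HasPath G v u k
  HasPath-reverse (p , isPath) = _ , IsPath-reverse isPath

  -- Pigeonhole: a path of length `k` lists `k + 1` distinct vertices.
  HasPath⇒< : ∀ {u v k} → HasPath G u v k → k ℕ.< n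
  HasPath⇒< (p , mkPath _ _ _ distinct) = Fin.injective⇒≤ (distinct _ _)

  module _ (conn : Connected G) where
    dist-sym-≤ : ∀ u v → dist G conn u v ℕ.≤ dist G conn v u
    dist-sym-≤ u v =
      let (_ , _ , minimal) = shortestPath G conn u v
          (k , path , _)    = shortestPath G conn v u
      in minimal k (HasPath-reverse path)

    dist-sym : ∀ u v → dist G conn u v ≡ dist G conn v u
    dist-sym u v = ℕ.≤-antisym (dist-sym-≤ u v) (dist-sym-≤ v u)

    dist< : ∀ u v → dist G conn u v ℕ.< n
    dist< u v = HasPath⇒< (proj₁ (proj₂ (shortestPath G conn u v)))

    dist≤diameter : ∀ u v → dist G conn u v ℕ.≤ diameter G conn
    dist≤diameter u v = All.lookup (xs≤max 0 distances)
      (List.∈-cartesianProductWith⁺ (dist G conn) (List.∈-allFin u) (List.∈-allFin v))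
      where distances = cartesianProductWith (dist G conn) (allFin n) (allFin n)

    diameter< : .{{_ : NonZero n}} → diameter G conn ℕ.< n
    -- The default value 0 of the maximum must also lie below `n`, whence the condition that `n` is
    -- nonzero.
    diameter< = max<v⁺ (ℕ.>-nonZero⁻¹ n) (All.cartesianProductWith⁺ (≡.setoid _) (≡.setoid _)
      (dist G conn) (allFin n) (allFin n) λ {u} {v} _ _ → dist< u v)

    weight : Matrix ℚ n
    weight u v = ℕ→ℚ (dist G conn u v)

    weight-sym : ∀ u v → weight u v ≡ weight v u
    weight-sym u v = cong ℕ→ℚ (dist-sym u v)

    distanceLaplacianℚ : Matrix ℚ n
    distanceLaplacianℚ i j = distanceLaplacian G conn i j ℚ./ 1

    distanceLaplacianℚ-laplacian : ∀ i j → distanceLaplacianℚ i j ≡ laplacian weight i j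
    distanceLaplacianℚ-laplacian = /1-laplacian (dist G conn)

    form-distanceLaplacian : ∀ y → form distanceLaplacianℚ y ≡ form (laplacian weight) y
    form-distanceLaplacian y = sum-cong-≋ λ i → cong (y i ℚ.*_)
      (sum-cong-≋ λ j → cong (ℚ._* y j) (distanceLaplacianℚ-laplacian i j))

    form-nonNeg : ∀ y → 0ℚ ℚ.≤ form distanceLaplacianℚ y
    form-nonNeg y = ℚ.≤-trans
      (laplacian-nonNeg weight-sym (λ u v → ℕ→ℚ-nonNeg (dist G conn u v)) y)
      (ℚ.≤-reflexive (sym (form-distanceLaplacian y)))

    form-≤ : ∀ y → form distanceLaplacianℚ y ℚ.≤ ℕ→ℚ (diameter G conn * n) ℚ.* norm² y
    form-≤ y = begin
      form distanceLaplacianℚ y                    ≡⟨ form-distanceLaplacian y ⟩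
      form (laplacian weight) y
        ≤⟨ laplacian-≤ weight-sym (ℕ→ℚ-nonNeg d)
             (λ u v → ℕ→ℚ-mono-≤ (dist≤diameter u v)) y ⟩
      sum {n} (const (ℕ→ℚ d)) ℚ.* norm² y
        ≡⟨ cong (ℚ._* norm² y) (trans (sym (ℕ→ℚ-sum {n} (const d)))
             (cong ℕ→ℚ (trans (sum-const n d) (ℕ.*-comm n d)))) ⟩
      ℕ→ℚ (d * n) ℚ.* norm² y                      ∎
      where
      open ℚ.≤-Reasoning
      d = diameter G conn

-- Counting the eigenvalues in the interval

theorem3p11 : ∀ {n : ℕ} .{{_ : NonZero n}} (G : Graph n) (conn : Connected G)
    (λs : Vector ℝ n) → Eigenvalues (distanceLaplacianℝ G conn) λs →
    let d = diameter G conn in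
    ∃[ m ] (Count [ ℕ→ℝ 0 , ℕ→ℝ (d * n) ] λs m × m ≥ d + 1)
theorem3p11 {n} G conn λs eigenvalues = n ,
  -- Every eigenvalue lies in the interval, so the counted subset is full and the count is `n`.
  (⊤ , ∣⊤∣≡n n , λ i → mk⇔
    (λ _ → (λ {ε} → eigenvalue-≥0 {A = A} {λs} eigenvalues (form-nonNeg G conn) i {ε}) ,
           (λ {ε} → eigenvalue-≤ {A = A} {λs} {b} eigenvalues (form-≤ G conn) i {ε}))
    (λ _ → ∈⊤)) ,
  -- The strict bound `d < n` unfolds to `1 + d ≤ n`; commuting the sum gives the required form.
  subst (ℕ._≤ n) (ℕ.+-comm 1 (diameter G conn)) (diameter< G conn)
  where
  A : Matrix ℚ n
  A = distanceLaplacianℚ G conn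
  b : ℚ
  b = ℕ→ℚ (diameter G conn * n)
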